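{- In the graceful game, Bob has a winning strategy on the square of the path $P_n^2$ for every $n\geq 4$, and Alice has a winning strategy on $P_3^2$ (no matter who starts).
   Context: $P_n$ is the path $(v_0,\dots,v_{n-1})$ on $n$ vertices; $P_n^2$ is the graph on the same vertex set in which two distinct vertices are adjacent iff their distance in $P_n$ is at most $2$ (so $|E(P_n^2)|=2n-3$ for $n\geq 2$). A graceful labeling of a graph $G$ with $m$ edges is an injective map $f\colon V(G)\to\{0,1,\dots,m\}$ such that the induced edge labels $|f(u)-f(v)|$, $uv\in E(G)$, are pairwise distinct. The graceful game on a simple graph $G$ with $m$ edges: two players, Alice and Bob, alternately choose a free (not yet labeled) vertex and assign to it a label from $\{0,1,\dots,m\}$ not yet used. An edge both of whose endpoints are labeled gets label $|f(u)-f(v)|$; a move is legal only if after it all edge labels are pairwise distinct. Alice wins if the whole graph ends up gracefully labeled; Bob wins if he can prevent this. Either player may be the first to move. -}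

module Defs where

open import Data.Nat using (ℕ; _+_; _*_; _∸_; _<_; _≤_; ∣_-_∣)
open import Data.Fin using (Fin; toℕ; _≟_)
open import Data.Maybe using (Maybe; just; nothing)
open import Data.Product using (Σ; _×_; _,_)
open import Data.Empty using (⊥)
open import Relation.Nullary using (¬_; yes; no)
open import Relation.Binary.PropositionalEquality using (_≡_; _≢_)

-- The square of the path P_n on vertices Fin n (v_i ↦ i).
-- An edge of P_n^2 is written as an ordered pair (i , j) with i < j ≤ i + 2;
-- this lists every edge of P_n^2 exactly once.
Edge : {n : ℕ} → Fin n → Fin n → Set
Edge i j = (toℕ i < toℕ j) × (toℕ j ≤ toℕ i + 2)

-- number of edges of P_n^2 (= 2n-3 for n ≥ 2)
edges : ℕ → ℕ
edges n = 2 * n ∸ 3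

Labeling : ℕ → Set
Labeling n = Fin n → Maybe ℕ

empty : {n : ℕ} → Labeling n
empty _ = nothing

assign : {n : ℕ} → Labeling n → Fin n → ℕ → Labeling n
assign f v l u with u ≟ v
... | yes _ = just l
... | no  _ = f u

EdgeLabelsDistinct : {n : ℕ} → Labeling n → Set
EdgeLabelsDistinct {n} f =
  (i j k l : Fin n) (a b c d : ℕ) →
  Edge i j → Edge k l → ¬ (i ≡ k × j ≡ l) →
  f i ≡ just a → f j ≡ just b → f k ≡ just c → f l ≡ just d →
  ∣ a - b ∣ ≢ ∣ c - d ∣

Legal : {n : ℕ} → Labeling n → Fin n → ℕ → Set
Legal {n} f v l =
  (f v ≡ nothing) × (l ≤ edges n) × ((u : Fin n) → f u ≢ just l)
  × EdgeLabelsDistinct (assign f v l)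

-- every vertex labeled (then, by legality of all moves, the labeling is graceful)
Complete : {n : ℕ} → Labeling n → Set
Complete {n} f = (v : Fin n) → f v ≢ nothing

data Player : Set where
  alice bob : Player

-- Alice has a winning strategy from position f with player p to move.
-- The game ends when the graph is fully labeled (Alice wins) or when the
-- player to move has no legal move (Bob wins, graph not gracefully labeled).
data AliceWins {n : ℕ} : Labeling n → Player → Set where
  finished : ∀ {f p} → Complete f → AliceWins f p
  aliceMoves : ∀ {f} (v : Fin n) (l : ℕ) → Legal f v l →
               AliceWins (assign f v l) bob → AliceWins f alice
  bobMoves : ∀ {f} → ¬ Complete f →
             Σ (Fin n) (λ v → Σ ℕ (λ l → Legal f v l)) →
             ((v : Fin n) (l : ℕ) → Legal f v l → AliceWins (assign f v l) alice) →
             AliceWins f bob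

data BobWins {n : ℕ} : Labeling n → Player → Set where
  stuck : ∀ {f p} → ¬ Complete f →
          ((v : Fin n) (l : ℕ) → ¬ Legal f v l) → BobWins f p
  bobMoves : ∀ {f} (v : Fin n) (l : ℕ) → Legal f v l →
             BobWins (assign f v l) alice → BobWins f bob
  aliceMoves : ∀ {f} → ¬ Complete f →
               ((v : Fin n) (l : ℕ) → Legal f v l → BobWins (assign f v l) bob) →
               BobWins f alice

{-# OPTIONS --safe #-}
module Submission where

-- Let m = 2n − 3. There are m edges and m possible edge labels, so a graceful labelling uses
-- each of 1, …, m; in particular 0 and m are adjacent, m − 1 comes from {0, m − 1} or {1, m},
-- and m − 2 from {0, m − 2}, {1, m − 1} or {2, m}. Bob wins once the position has no graceful
-- extension, because from then on any play leads to a dead end.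
--
-- Up to reflection and the complement l ↦ m − l, for n ≥ 9 Bob puts 0 on an end vertex v₀ whose
-- neighbourhood is only {v₁, v₂} and which lies away from Alice's opening x on v. Unless Alice
-- puts m next to it, Bob puts m elsewhere. If she does, Bob puts 1 on v₅, which makes m − 1 and
-- m − 2 incompatible; when v = v₅ he instead puts n − 1 on v₂ (if m is on v₁) or x − 1 on v₁ (if
-- m is on v₂), which makes m − 1 impossible. If Alice opens with 0, Bob puts m out of its reach.
--
-- For 4 ≤ n ≤ 8 Bob's second move still always reaches a position in which m, m − 1 and m − 2
-- cannot all be realised; this, and the game on three vertices, is verified by evaluation.

open import Defs
open import Data.Nat using (ℕ; _≥_)
open import Data.Product using (_×_)
open import Data.Nat using (zero; suc; _+_; _*_; _∸_; _≤_; _<_; z≤n; s≤s; ∣_-_∣; ⌊_/2⌋; ⌈_/2⌉; pred)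
import Data.Nat as ℕ
open import Data.Nat.Properties
open import Data.Fin using (Fin; zero; suc; toℕ; fromℕ<; opposite; punchOut)
import Data.Fin as Fin
open import Data.Fin.Patterns
import Data.Fin.Properties as Finₚ
open import Data.Maybe as Maybe using (Maybe; just; nothing)
open import Data.Maybe.Properties using (just-injective)
open import Data.Product using (∃-syntax; _,_; proj₁; proj₂)
open import Data.Product.Properties using (≡-dec)
open import Data.Sum using (_⊎_; inj₁; inj₂; swap; [_,_]′)
open import Data.Empty using (⊥)
open import Data.Unit using (tt)
open import Data.Bool using (Bool; true; false; T; _∧_; _∨_; not; if_then_else_)
open import Data.Bool.ListAction using (all; any)
open import Data.Bool.Properties using (T-∧; T-∨)
open import Data.List using (List; []; _∷_; length; lookup; allFin; upTo)
open import Data.List.Relation.Unary.All as All using (All; []; _∷_)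
import Data.List.Relation.Unary.All.Properties as Allₚ
open import Data.List.Relation.Unary.AllPairs as AllPairs using (AllPairs; []; _∷_)
open import Data.List.Relation.Unary.Any as Any using (Any; here; there)
import Data.List.Relation.Unary.Any.Properties as Anyₚ
open import Data.List.Membership.Propositional using (_∈_)
open import Data.List.Membership.Propositional.Properties using (∈-lookup; ∈-allFin; ∈-upTo⁺)
open import Function using (_∘_; Injective)
open import Function.Bundles using (Equivalence)
open import Relation.Nullary using (¬_; Dec; yes; no; contradiction; does)
open import Relation.Nullary.Decidable using (_×-dec_; _⊎-dec_; _→-dec_; ¬?; map′; from-no; from-yes)
open import Relation.Binary.PropositionalEquality using (_≡_; _≢_; refl; sym; trans; cong; cong₂; subst; subst₂; module ≡-Reasoning)

private
  variable
    n : ℕ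

-- Edges as unordered pairs

Adj : Fin n → Fin n → Set
Adj i j = Edge i j ⊎ Edge j i

adj? : (i j : Fin n) → Dec (Adj i j)
adj? i j = edge? i j ⊎-dec edge? j i
  where
  edge? : (i j : Fin n) → Dec (Edge i j)
  edge? i j = (toℕ i ℕ.<? toℕ j) ×-dec (toℕ j ℕ.≤? toℕ i + 2)

far⇒¬Adj : {i j : Fin n} → 3 + toℕ i ≤ toℕ j → ¬ Adj i j
far⇒¬Adj {i = i} far (inj₁ (_ , near)) =
  <-irrefl refl (≤-trans (subst (_< 3 + toℕ i) (+-comm 2 (toℕ i)) ≤-refl) (≤-trans far near))
far⇒¬Adj far (inj₂ (back , _)) = <-asym back (≤-trans (s≤s (m≤n+m _ 2)) far)

Adj⇒≢ : {i j : Fin n} → Adj i j → i ≢ j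
Adj⇒≢ (inj₁ (i<i , _)) refl = <-irrefl refl i<i
Adj⇒≢ (inj₂ (i<i , _)) refl = <-irrefl refl i<i

SameEdge : (i j k l : Fin n) → Set
SameEdge i j k l = (i ≡ k × j ≡ l) ⊎ (i ≡ l × j ≡ k)

-- The unordered form of EdgeLabelsDistinct.
Separated : Labeling n → Set
Separated {n} f = ∀ {i j k l : Fin n} {a b c d} → Adj i j → Adj k l →
  f i ≡ just a → f j ≡ just b → f k ≡ just c → f l ≡ just d →
  ∣ a - b ∣ ≡ ∣ c - d ∣ → SameEdge i j k l

distinct⇒separated : {f : Labeling n} → EdgeLabelsDistinct f → Separated f
distinct⇒separated {f = f} distinct = go
  where
  ordered : ∀ {i j k l a b c d} → Edge i j → Edge k l →
    f i ≡ just a → f j ≡ just b → f k ≡ just c → f l ≡ just d →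
    ∣ a - b ∣ ≡ ∣ c - d ∣ → i ≡ k × j ≡ l
  ordered {i} {j} {k} {l} e e′ fi fj fk fl eq with i Fin.≟ k | j Fin.≟ l
  ... | yes i≡k | yes j≡l = i≡k , j≡l
  ... | no  i≢k | _       =
    contradiction eq (distinct _ _ _ _ _ _ _ _ e e′ (i≢k ∘ proj₁) fi fj fk fl)
  ... | yes _   | no j≢l  =
    contradiction eq (distinct _ _ _ _ _ _ _ _ e e′ (j≢l ∘ proj₂) fi fj fk fl)

  go : Separated f
  go {a = a} {b} {c} {d} (inj₁ e) (inj₁ e′) fi fj fk fl eq =
    inj₁ (ordered e e′ fi fj fk fl eq)
  go {a = a} {b} {c} {d} (inj₁ e) (inj₂ e′) fi fj fk fl eq =
    inj₂ (ordered e e′ fi fj fl fk (trans eq (∣-∣-comm c d)))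
  go {a = a} {b} {c} {d} (inj₂ e) (inj₁ e′) fi fj fk fl eq
    with p , q ← ordered e e′ fj fi fk fl (trans (∣-∣-comm b a) eq) = inj₂ (q , p)
  go {a = a} {b} {c} {d} (inj₂ e) (inj₂ e′) fi fj fk fl eq
    with p , q ← ordered e e′ fj fi fl fk (trans (∣-∣-comm b a) (trans eq (∣-∣-comm c d)))
    = inj₁ (q , p)

separated⇒distinct : {f : Labeling n} → Separated f → EdgeLabelsDistinct f
separated⇒distinct sep i j k l a b c d e e′ different fi fj fk fl eq
  with sep (inj₁ e) (inj₁ e′) fi fj fk fl eq
... | inj₁ same = different same
... | inj₂ (refl , refl) = <-asym (proj₁ e) (proj₁ e′)

module _ (f : Labeling n) (v : Fin n) (l : ℕ) where

  assign-at : assign f v l v ≡ just l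
  assign-at with v Fin.≟ v
  ... | yes _   = refl
  ... | no  v≢v = contradiction refl v≢v

  assign-other : ∀ {u} → u ≢ v → assign f v l u ≡ f u
  assign-other {u} u≢v with u Fin.≟ v
  ... | yes u≡v = contradiction u≡v u≢v
  ... | no  _   = refl

  assign-inv : ∀ u {b} → assign f v l u ≡ just b →
    (u ≡ v × b ≡ l) ⊎ (u ≢ v × f u ≡ just b)
  assign-inv u eq with u Fin.≟ v
  ... | yes u≡v = inj₁ (u≡v , sym (just-injective eq))
  ... | no  u≢v = inj₂ (u≢v , eq)

-- Positions are move lists, latest move first.

Position : ℕ → Set
Position n = List (Fin n × ℕ)

-- The list is finite data on which legality can be decided, while `f` is the function that the game
-- speaks of. Because the legality of every move is recorded, injectivity, bounds and separation
-- follow by induction.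
data Reachable {n} : Position n → Labeling n → Set where
  start : Reachable [] empty
  move  : ∀ {ps f v l} → Reachable ps f → Legal f v l →
          Reachable ((v , l) ∷ ps) (assign f v l)

private
  variable
    ps : Position n
    f  : Labeling n

Agrees : Labeling n → Position n → Set
Agrees f = All λ (i , b) → f i ≡ just b

listed : Reachable ps f → ∀ {i b} → f i ≡ just b → (i , b) ∈ ps
listed start ()
listed (move {f = f} {v} {l} r _) {i} eq with assign-inv f v l i eq
... | inj₁ (refl , refl) = here refl
... | inj₂ (_ , fi)      = there (listed r fi)

agrees-other : {f : Labeling n} {ps : Position n} {v : Fin n} {l : ℕ} →
  f v ≡ nothing → Agrees f ps → Agrees (assign f v l) ps
agrees-other {f = f} {v = v} {l} free =
  All.map λ {(i , b)} fi → trans (assign-other f v l (λ where refl → impossible free fi)) fi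
  where
  impossible : ∀ {b} → f v ≡ nothing → f v ≡ just b → ⊥
  impossible none some with () ← trans (sym none) some

agrees : Reachable ps f → Agrees f ps
agrees start = []
agrees (move {f = f} {v} {l} r (free , _)) = assign-at f v l ∷ agrees-other free (agrees r)

fresh-vertex : {f : Labeling n} {ps : Position n} {v : Fin n} →
  f v ≡ nothing → Agrees f ps → All (λ (i , _) → i ≢ v) ps
fresh-vertex free = All.map λ fi → λ where refl → nothing≢just (trans (sym free) fi)
  where
  nothing≢just : {b : ℕ} → nothing ≢ just b
  nothing≢just ()

DifferentVertices : Fin n × ℕ → Fin n × ℕ → Set
DifferentVertices (i , _) (j , _) = i ≢ j

vertices-unique : Reachable ps f → AllPairs DifferentVertices ps
vertices-unique start = []
vertices-unique (move r (free , _)) =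
  All.map (λ i≢v v≡i → i≢v (sym v≡i)) (fresh-vertex free (agrees r)) ∷ vertices-unique r

separated : Reachable ps f → Separated f
separated start _ _ ()
separated (move _ (_ , _ , _ , distinct)) = distinct⇒separated distinct

labels-injective : Reachable ps f → ∀ {i j b} → f i ≡ just b → f j ≡ just b → i ≡ j
labels-injective start ()
labels-injective (move {f = f} {v} {l} r (_ , _ , unused , _)) {i} {j} fi fj
  with assign-inv f v l i fi | assign-inv f v l j fj
... | inj₁ (refl , _)   | inj₁ (refl , _)   = refl
... | inj₁ (_ , refl)   | inj₂ (_ , fj′)    = contradiction fj′ (unused _)
... | inj₂ (_ , fi′)    | inj₁ (_ , refl)   = contradiction fi′ (unused _)
... | inj₂ (_ , fi′)    | inj₂ (_ , fj′)    = labels-injective r fi′ fj′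

labels-bounded : Reachable {n} ps f → ∀ {i b} → f i ≡ just b → b ≤ edges n
labels-bounded start ()
labels-bounded (move {f = f} {v} {l} r (_ , b≤m , _)) {i} fi with assign-inv f v l i fi
... | inj₁ (_ , refl) = b≤m
... | inj₂ (_ , fi′)  = labels-bounded r fi′

unique⇒length≤n : AllPairs (DifferentVertices {n}) ps → length ps ≤ n
unique⇒length≤n {ps = ps} uniq = Finₚ.injective⇒≤ {f = λ k → proj₁ (lookup ps k)} (lookup-injective uniq)
  where
  lookup-injective : ∀ {ps : Position n} → AllPairs DifferentVertices ps →
    ∀ {k l} → proj₁ (lookup ps k) ≡ proj₁ (lookup ps l) → k ≡ l
  lookup-injective (_ ∷ _)    {zero}  {zero}  _  = refl
  lookup-injective (v∉ ∷ _)   {zero}  {suc l} eq = contradiction eq (All.lookup v∉ (∈-lookup l))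
  lookup-injective (v∉ ∷ _)   {suc k} {zero}  eq = contradiction (sym eq) (All.lookup v∉ (∈-lookup k))
  lookup-injective (_ ∷ uniq) {suc k} {suc l} eq = cong suc (lookup-injective uniq eq)

-- Legality of a move, decided on the move list

NewEdgesDiffer : Position n → Fin n → ℕ → Set
NewEdgesDiffer ps w l =
  AllPairs (λ (i , b) (j , c) → Adj w i → Adj w j → ∣ l - b ∣ ≢ ∣ l - c ∣) ps

NewEdgesNotOld : Position n → Fin n → ℕ → Set
NewEdgesNotOld ps w l =
  All (λ (i , b) → Adj w i →
    AllPairs (λ (j , c) (k , d) → Adj j k → ∣ l - b ∣ ≢ ∣ c - d ∣) ps) ps

-- Only edges at `w` are new, so they are compared with each other and with the old edges; the old
-- edges differ among themselves by reachability. Testing each pair of entries in one order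
-- suffices, because adjacency and the distance of labels are symmetric.
Admissible : Position n → Fin n → ℕ → Set
Admissible {n} ps w l =
  All (λ (i , b) → i ≢ w × b ≢ l) ps × l ≤ edges n
  × NewEdgesDiffer ps w l × NewEdgesNotOld ps w l

admissible? : (ps : Position n) (w : Fin n) (l : ℕ) → Dec (Admissible ps w l)
admissible? {n} ps w l =
  All.all? (λ (i , b) → ¬? (i Fin.≟ w) ×-dec ¬? (b ℕ.≟ l)) ps
  ×-dec l ℕ.≤? edges n
  ×-dec AllPairs.allPairs?
    (λ (i , b) (j , c) → adj? w i →-dec adj? w j →-dec ¬? (∣ l - b ∣ ℕ.≟ ∣ l - c ∣)) ps
  ×-dec All.all? (λ (i , b) → adj? w i →-dec
    AllPairs.allPairs? (λ (j , c) (k , d) → adj? j k →-dec ¬? (∣ l - b ∣ ℕ.≟ ∣ c - d ∣)) ps) ps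

module _ {a ℓ} {A : Set a} {R : A → A → Set ℓ} where

  allPairs-lookup : ∀ {xs} → AllPairs R xs → ∀ {x y} → x ∈ xs → y ∈ xs → x ≡ y ⊎ R x y ⊎ R y x
  allPairs-lookup (_ ∷ _)    (here refl) (here refl) = inj₁ refl
  allPairs-lookup (rs ∷ _)   (here refl) (there y∈)  = inj₂ (inj₁ (All.lookup rs y∈))
  allPairs-lookup (rs ∷ _)   (there x∈)  (here refl) = inj₂ (inj₂ (All.lookup rs x∈))
  allPairs-lookup (_ ∷ rest) (there x∈)  (there y∈)  = allPairs-lookup rest x∈ y∈

module _ {a ℓ ℓ′} {A : Set a} {R : A → A → Set ℓ} {S : A → A → Set ℓ′} where

  allPairs-map∈ : ∀ {xs} → (∀ {x y} → x ∈ xs → y ∈ xs → R x y → S x y) → AllPairs R xs → AllPairs S xs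
  allPairs-map∈ h []           = []
  allPairs-map∈ h (rs ∷ rest) =
    All.tabulate (λ y∈ → h (here refl) (there y∈) (All.lookup rs y∈))
    ∷ allPairs-map∈ (λ x∈ y∈ → h (there x∈) (there y∈)) rest

module _ {ps : Position n} {h : Labeling n} (sep : Separated h) (h∼ps : Agrees h ps)
         (uniq : AllPairs DifferentVertices ps) {w : Fin n} {l : ℕ}
         (fresh : All (λ (i , _) → i ≢ w) ps) (hw : h w ≡ just l) where

  -- A coincidence would identify two edges, and so equate two vertices of `ps` or put `w` into
  -- `ps`. The labelling `h` is arbitrary in order to cover two uses: the position just after a
  -- move, and a total graceful labelling that extends `ps`.
  separated⇒newEdges : NewEdgesDiffer ps w l × NewEdgesNotOld ps w l
  separated⇒newEdges = allPairs-map∈ differ uniq , All.tabulate λ i∈ w~i →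
      allPairs-map∈ (λ j∈ k∈ _ j~k eq → notOld i∈ w~i j∈ k∈ j~k eq) uniq
    where
    differ : ∀ {x y} → x ∈ ps → y ∈ ps → DifferentVertices x y →
      Adj w (proj₁ x) → Adj w (proj₁ y) → ∣ l - proj₂ x ∣ ≢ ∣ l - proj₂ y ∣
    differ i∈ j∈ i≢j w~i w~j eq
      with sep w~i w~j hw (All.lookup h∼ps i∈) hw (All.lookup h∼ps j∈) eq
    ... | inj₁ (_ , i≡j) = i≢j i≡j
    ... | inj₂ (w≡j , _) = All.lookup fresh j∈ (sym w≡j)

    notOld : ∀ {i b j c k d} → (i , b) ∈ ps → Adj w i → (j , c) ∈ ps → (k , d) ∈ ps →
      Adj j k → ∣ l - b ∣ ≢ ∣ c - d ∣
    notOld i∈ w~i j∈ k∈ j~k eq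
      with sep w~i j~k hw (All.lookup h∼ps i∈) (All.lookup h∼ps j∈) (All.lookup h∼ps k∈) eq
    ... | inj₁ (w≡j , _) = All.lookup fresh j∈ (sym w≡j)
    ... | inj₂ (w≡k , _) = All.lookup fresh k∈ (sym w≡k)

module _ {ps : Position n} {f : Labeling n} (r : Reachable ps f) {w : Fin n} {l : ℕ} where

  legal⇒admissible : Legal f w l → Admissible ps w l
  legal⇒admissible (free , l≤m , unused , distinct) =
    All.zip (fresh , All.map (λ fi → λ where refl → unused _ fi) (agrees r)) , l≤m ,
    separated⇒newEdges (distinct⇒separated distinct) (agrees-other free (agrees r))
      (vertices-unique r) fresh (assign-at f w l)
    where
    fresh = fresh-vertex free (agrees r)

  -- Each edge after the move is old or joins `w` to a listed vertex. Two old edges are separated by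
  -- reachability, an old and a new one by `clash`, two new ones by `differ`.
  admissible⇒legal : Admissible ps w l → Legal f w l
  admissible⇒legal (fresh , l≤m , differ , notOld) = free , l≤m , unused , separated⇒distinct sep
    where
    free : f w ≡ nothing
    free with f w in eq
    ... | nothing = refl
    ... | just b  = contradiction refl (proj₁ (All.lookup fresh (listed r eq)))

    unused : ∀ u → f u ≢ just l
    unused u eq = proj₂ (All.lookup fresh (listed r eq)) refl

    OldEdge NewEdge : Fin n → ℕ → Fin n → ℕ → Set
    OldEdge i a j b = f i ≡ just a × f j ≡ just b
    NewEdge i a j b = ∃[ o ] ∃[ c ] Adj w o × (o , c) ∈ ps × ∣ a - b ∣ ≡ ∣ l - c ∣ × SameEdge i j w o

    view : ∀ {i a j b} → Adj i j → assign f w l i ≡ just a → assign f w l j ≡ just b →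
      OldEdge i a j b ⊎ NewEdge i a j b
    view {i} {a} {j} i~j fi fj with assign-inv f w l i fi | assign-inv f w l j fj
    ... | inj₁ (refl , _)    | inj₁ (refl , _)    = contradiction refl (Adj⇒≢ i~j)
    ... | inj₁ (refl , refl) | inj₂ (_ , fj′)     =
      inj₂ (_ , _ , i~j , listed r fj′ , refl , inj₁ (refl , refl))
    ... | inj₂ (_ , fi′)     | inj₁ (refl , refl) =
      inj₂ (_ , _ , swap i~j , listed r fi′ , ∣-∣-comm a l , inj₂ (refl , refl))
    ... | inj₂ (_ , fi′)     | inj₂ (_ , fj′)     = inj₁ (fi′ , fj′)

    clash : ∀ {o b j c k d} → Adj w o → (o , b) ∈ ps → Adj j k → f j ≡ just c → f k ≡ just d →
      ∣ l - b ∣ ≢ ∣ c - d ∣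
    clash {c = c} {d = d} w~o o∈ j~k fj fk eq
      with allPairs-lookup (All.lookup notOld o∈ w~o) (listed r fj) (listed r fk)
    ... | inj₁ refl        = Adj⇒≢ j~k refl
    ... | inj₂ (inj₁ diff) = diff j~k eq
    ... | inj₂ (inj₂ diff) = diff (swap j~k) (trans eq (∣-∣-comm c d))

    combine : ∀ {i j k m o} → SameEdge {n} i j w o → SameEdge k m w o → SameEdge i j k m
    combine (inj₁ (refl , refl)) (inj₁ (refl , refl)) = inj₁ (refl , refl)
    combine (inj₁ (refl , refl)) (inj₂ (refl , refl)) = inj₂ (refl , refl)
    combine (inj₂ (refl , refl)) (inj₁ (refl , refl)) = inj₂ (refl , refl)
    combine (inj₂ (refl , refl)) (inj₂ (refl , refl)) = inj₁ (refl , refl)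

    sep : Separated (assign f w l)
    sep i~j k~m fi fj fk fm eq with view i~j fi fj | view k~m fk fm
    ... | inj₁ (fi′ , fj′) | inj₁ (fk′ , fm′) = separated r i~j k~m fi′ fj′ fk′ fm′ eq
    ... | inj₁ (fi′ , fj′) | inj₂ (_ , _ , w~o , o∈ , eq′ , _) =
      contradiction (sym (trans eq eq′)) (clash w~o o∈ i~j fi′ fj′)
    ... | inj₂ (_ , _ , w~o , o∈ , eq′ , _) | inj₁ (fk′ , fm′) =
      contradiction (trans (sym eq′) eq) (clash w~o o∈ k~m fk′ fm′)
    ... | inj₂ (o , _ , w~o , o∈ , eq′ , same) | inj₂ (o′ , _ , w~o′ , o∈′ , eq″ , same′)
      with allPairs-lookup differ o∈ o∈′
    ... | inj₁ refl        = combine same same′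
    ... | inj₂ (inj₁ diff) = contradiction (trans (sym eq′) (trans eq eq″)) (diff w~o w~o′)
    ... | inj₂ (inj₂ diff) = contradiction (trans (sym eq″) (trans (sym eq) eq′)) (diff w~o′ w~o)

  legal? : Dec (Legal f w l)
  legal? = map′ admissible⇒legal legal⇒admissible (admissible? ps w l)

-- Doomed positions

record Graceful (g : Fin n → ℕ) : Set where
  field
    bounded   : ∀ i → g i ≤ edges n
    injective : ∀ {i j} → g i ≡ g j → i ≡ j
    separates : Separated (just ∘ g)

-- The quantifier runs over total labellings and not over further play, so doom is inherited by
-- every continuation and can be proved from edge labels alone.
Doomed : Position n → Set
Doomed {n} ps = (g : Fin n → ℕ) → Graceful g → All (λ (i , b) → g i ≡ b) ps → ⊥

doomed-tail : ∀ {p} → Doomed ps → Doomed (p ∷ ps)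
doomed-tail doomed g graceful (_ ∷ rest) = doomed g graceful rest

doomed⇒incomplete : Reachable {n} ps f → Doomed ps → ¬ Complete f
doomed⇒incomplete {n} {ps} {f} r doomed complete = doomed g graceful agree
  where
  value : ∀ v → ∃[ b ] f v ≡ just b
  value v with f v in eq
  ... | just b  = b , refl
  ... | nothing = contradiction eq (complete v)

  g : Fin n → ℕ
  g v = proj₁ (value v)

  f≡g : ∀ v {a} → just (g v) ≡ just a → f v ≡ just a
  f≡g v eq = trans (proj₂ (value v)) eq

  graceful : Graceful g
  graceful = record
    { bounded   = λ i → labels-bounded r (proj₂ (value i))
    ; injective = λ {i} {j} eq → labels-injective r (f≡g i refl) (f≡g j (cong just (sym eq)))
    ; separates = λ i~j k~l gi gj gk gl → separated r i~j k~l (f≡g _ gi) (f≡g _ gj) (f≡g _ gk) (f≡g _ gl)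
    }

  agree : All (λ (i , b) → g i ≡ b) ps
  agree = All.map (λ {(i , b)} fi → just-injective (trans (sym (proj₂ (value i))) fi)) (agrees r)

-- A legal label is at most `edges n`, so a finite search is exhaustive.
legalMove? : Reachable {n} ps f → Dec (∃[ v ] ∃[ l ] Legal f v l)
legalMove? {n} {f = f} r =
  map′ (λ (v , k , legal) → v , toℕ k , legal)
       (λ (v , l , legal@(_ , l≤m , _)) → v , fromℕ< (s≤s l≤m) ,
          subst (Legal f v) (sym (Finₚ.toℕ-fromℕ< (s≤s l≤m))) legal)
       (Finₚ.any? λ v → Finₚ.any? {n = suc (edges n)} λ k → legal? r {v} {toℕ k})

-- No completion can be reached any more, so Bob may make an arbitrary legal move, and has won if
-- there is none. Play ends because `length ps` never exceeds `n`; `fuel` bounds the number of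
-- vertices still free.
doomed⇒BobWins : Reachable {n} ps f → Doomed ps → ∀ p → BobWins f p
doomed⇒BobWins {n} {ps} r doomed p = play (n ∸ length ps)
  (≤-reflexive (sym (m+[n∸m]≡n (unique⇒length≤n (vertices-unique r))))) r doomed p
  where
  play : ∀ fuel {ps f} → n ≤ length ps + fuel → Reachable {n} ps f → Doomed ps → ∀ p → BobWins f p
  play zero {ps} full r doomed p = stuck (doomed⇒incomplete r doomed) λ v l legal →
    <-irrefl refl (≤-trans (unique⇒length≤n (vertices-unique (move r legal)))
      (subst (n ≤_) (+-identityʳ (length ps)) full))
  play (suc fuel) {ps} enough r doomed alice = aliceMoves (doomed⇒incomplete r doomed) λ v l legal →
    play fuel (subst (n ≤_) (+-suc (length ps) fuel) enough) (move r legal) (doomed-tail doomed) bob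
  play (suc fuel) {ps} enough r doomed bob with legalMove? r
  ... | yes (v , l , legal) = bobMoves v l legal
    (play fuel (subst (n ≤_) (+-suc (length ps) fuel) enough) (move r legal) (doomed-tail doomed) alice)
  ... | no none = stuck (doomed⇒incomplete r doomed) λ v l legal → none (v , l , legal)

-- Every edge label occurs

-- A missed `y` could be punched out of the codomain, leaving an injection of `Fin (suc m)` into
-- `Fin m`.
injective⇒surjective : ∀ {m} {φ : Fin m → Fin m} → Injective _≡_ _≡_ φ → ∀ y → ∃[ x ] φ x ≡ y
injective⇒surjective {suc m} {φ} inj y with Finₚ.any? (λ x → φ x Fin.≟ y)
... | yes found  = found
... | no  missed = contradiction
  (Finₚ.injective⇒≤ {f = λ x → punchOut (avoids x)}
    (λ eq → inj (Finₚ.punchOut-injective (avoids _) (avoids _) eq)))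
  1+n≰n
  where
  avoids : ∀ x → y ≢ φ x
  avoids x y≡φx = missed (x , sym y≡φx)

-- The k-th edge joins ⌊k/2⌋ and 1 + ⌈k/2⌉; its endpoints sum to 1 + k, so distinct k give distinct edges.
module EdgeEnumeration (n : ℕ) (k : Fin (edges n)) where

  private
    κ : ℕ
    κ = toℕ k

    hi<n : suc ⌈ κ /2⌉ < n
    -- `⌈ 4 + κ /2⌉` computes to `2 + ⌈ κ /2⌉`, and half of `2 * n` is `n`.
    hi<n = subst (suc (suc ⌈ κ /2⌉) ≤_)
      (trans (cong (λ s → ⌈ n + s /2⌉) (+-identityʳ n)) (sym (n≡⌈n+n/2⌉ n)))
      (⌈n/2⌉-mono (subst (_≤ 2 * n) (+-comm (suc κ) 3) 4+κ≤2n))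
      where
      κ<m : κ < 2 * n ∸ 3
      κ<m = Finₚ.toℕ<n k

      4+κ≤2n : suc κ + 3 ≤ 2 * n
      -- As `κ` lies below `2 * n ∸ 3`, this difference is nonzero, so the subtraction is not
      -- truncated.
      4+κ≤2n = subst (suc κ + 3 ≤_)
        (m∸n+n≡m {2 * n} {3} (<⇒≤ (m∸n≢0⇒n<m λ m≡0 → n≮0 (subst (κ <_) m≡0 κ<m))))
        (+-monoˡ-≤ 3 κ<m)

  lower upper : Fin n
  lower = fromℕ< (≤-<-trans (⌊n/2⌋≤⌈n/2⌉ κ) (<-trans (n<1+n _) hi<n))
  upper = fromℕ< hi<n

  toℕ-lower : toℕ lower ≡ ⌊ κ /2⌋
  toℕ-lower = Finₚ.toℕ-fromℕ< _

  toℕ-upper : toℕ upper ≡ suc ⌈ κ /2⌉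
  toℕ-upper = Finₚ.toℕ-fromℕ< hi<n

  lower-upper-edge : Edge lower upper
  lower-upper-edge =
    subst₂ _<_ (sym toℕ-lower) (sym toℕ-upper) (s≤s (⌊n/2⌋≤⌈n/2⌉ κ)) ,
    subst₂ _≤_ (sym toℕ-upper) (cong (_+ 2) (sym toℕ-lower)) (near κ)
    where
    near : ∀ j → suc ⌈ j /2⌉ ≤ ⌊ j /2⌋ + 2
    near zero          = s≤s z≤n
    near (suc zero)    = ≤-refl
    near (suc (suc j)) = s≤s (near j)

  lower+upper : toℕ lower + toℕ upper ≡ suc κ
  lower+upper = trans (cong₂ _+_ toℕ-lower toℕ-upper)
    (trans (+-suc ⌊ κ /2⌋ ⌈ κ /2⌉) (cong suc (⌊n/2⌋+⌈n/2⌉≡n κ)))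

module _ {g : Fin n → ℕ} (graceful : Graceful g) where
  open Graceful graceful
  open EdgeEnumeration n

  private
    label : Fin (edges n) → ℕ
    label k = ∣ g (lower k) - g (upper k) ∣

    label≤m : ∀ k → label k ≤ edges n
    label≤m k = ≤-trans (∣m-n∣≤m⊔n (g (lower k)) (g (upper k))) (⊔-lub (bounded _) (bounded _))

    label>0 : ∀ k → 0 < label k
    label>0 k = n≢0⇒n>0 λ eq →
      Adj⇒≢ (inj₁ (lower-upper-edge k)) (injective (∣m-n∣≡0⇒m≡n eq))

    pred-label<m : ∀ k → pred (label k) < edges n
    pred-label<m k = subst (_≤ edges n) (sym (suc-pred (label k) {{ℕ.>-nonZero (label>0 k)}})) (label≤m k)

    -- Injectivity of `g` excludes the edge label 0, so lowering labels by one sends the edges into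
    -- a set of the same size, where an injective map is surjective.
    slot : Fin (edges n) → Fin (edges n)
    slot k = fromℕ< (pred-label<m k)

    toℕ-slot : ∀ k → suc (toℕ (slot k)) ≡ label k
    toℕ-slot k = trans (cong suc (Finₚ.toℕ-fromℕ< (pred-label<m k)))
      (suc-pred (label k) {{ℕ.>-nonZero (label>0 k)}})

    endpoints-sum : ∀ {k l} → SameEdge (lower k) (upper k) (lower l) (upper l) →
      toℕ (lower k) + toℕ (upper k) ≡ toℕ (lower l) + toℕ (upper l)
    endpoints-sum (inj₁ (p , q)) = cong₂ (λ i j → toℕ i + toℕ j) p q
    endpoints-sum {k} {l} (inj₂ (p , q)) =
      trans (cong₂ (λ i j → toℕ i + toℕ j) p q) (+-comm (toℕ (upper l)) (toℕ (lower l)))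

    slot-injective : ∀ {k l} → slot k ≡ slot l → k ≡ l
    slot-injective {k} {l} eq = Finₚ.toℕ-injective (suc-injective
      (trans (sym (lower+upper k)) (trans (endpoints-sum {k} {l} same) (lower+upper l))))
      where
      same : SameEdge (lower k) (upper k) (lower l) (upper l)
      same = separates (inj₁ (lower-upper-edge k)) (inj₁ (lower-upper-edge l)) refl refl refl refl
        (trans (sym (toℕ-slot k)) (trans (cong (suc ∘ toℕ) eq) (toℕ-slot l)))

    oriented : ∀ {i j d} → Adj i j → ∣ g i - g j ∣ ≡ d → ∃[ p ] ∃[ q ] Adj p q × g q ≡ g p + d
    oriented {i} {j} i~j refl with ≤-total (g i) (g j)
    ... | inj₁ le = i , j , i~j ,
      trans (sym (m+[n∸m]≡n le)) (cong (g i +_) (sym (m≤n⇒∣m-n∣≡n∸m le)))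
    ... | inj₂ ge = j , i , swap i~j ,
      trans (sym (m+[n∸m]≡n ge)) (cong (g j +_) (sym (m≤n⇒∣n-m∣≡n∸m ge)))

    edge-labelled : ∀ {d} (d<m : d < edges n) → ∃[ k ] slot k ≡ fromℕ< d<m →
      ∃[ p ] ∃[ q ] Adj p q × g q ≡ g p + suc d
    edge-labelled d<m (k , eq) = oriented (inj₁ (lower-upper-edge k))
      (trans (sym (toℕ-slot k)) (cong suc (trans (cong toℕ eq) (Finₚ.toℕ-fromℕ< d<m))))

  -- Abstract because with-abstraction would otherwise unfold the whole pigeonhole argument.
  abstract
    every-label-occurs : ∀ {d} → 0 < d → d ≤ edges n → ∃[ p ] ∃[ q ] Adj p q × g q ≡ g p + d
    every-label-occurs {suc d} _ d<m =
      edge-labelled d<m (injective⇒surjective slot-injective (fromℕ< d<m))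

-- A decision procedure for small n

allWhere : {A : Set} {Q : A → Set} → (∀ x → Dec (Q x)) → (A → Bool) → List A → Bool
allWhere Q? p = all (λ x → not (does (Q? x)) ∨ p x)

-- A pair already present is accepted as it stands. An inadmissible placement refutes the attempt at
-- once, hence the final `true`.
place : Position n → Fin n → ℕ → (Position n → Bool) → Bool
place ps p a next =
  if does (Any.any? (≡-dec Fin._≟_ ℕ._≟_ (p , a)) ps) then next ps
  else if does (admissible? ps p a) then next ((p , a) ∷ ps) else true

-- Tries to realise the edge labels d, …, d − k + 1 one after the other in every possible way;
-- true means that all attempts fail.
doomedᵇ : ℕ → ℕ → Position n → Bool
doomedᵇ zero    d ps = false
doomedᵇ {n} (suc k) d ps =
  all (λ p → all (λ a → place ps p a λ qs →
    allWhere (adj? p) (λ q → place qs q (a + d) (doomedᵇ k (pred d))) (allFin n))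
    -- The smaller end `a` of an edge labelled `d` satisfies `a + d ≤ edges n`.
    (upTo (suc (edges n ∸ d)))) (allFin n)

dooming : Position n → Bool
dooming {n} = doomedᵇ 3 (edges n)

someLegal everyLegal : Position n → (Position n → Bool) → Bool
-- All labels up to `edges n` are covered. The largest comes first because an extreme label is a
-- natural choice for Bob and the search stops at its first success.
someLegal {n} ps next = any (λ l → any (λ v →
  does (admissible? ps v l) ∧ next ((v , l) ∷ ps)) (allFin n)) (edges n ∷ upTo (edges n))
everyLegal {n} ps next = all (λ v →
  allWhere (admissible? ps v) (λ l → next ((v , l) ∷ ps)) (upTo (suc (edges n)))) (allFin n)

-- The search looks two moves of Bob ahead: after his reply, each move of Alice must be dooming
-- itself or allow a dooming answer. The length test supplies the incompleteness that the
-- constructor `aliceMoves` demands.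
bobDooms aliceLost aliceTrapped bobReplies : Position n → Bool
bobDooms ps = someLegal ps dooming
aliceLost ps = dooming ps ∨ bobDooms ps
aliceTrapped {n} ps = does (length ps ℕ.<? n) ∧ everyLegal ps aliceLost
bobReplies ps = someLegal ps aliceTrapped

-- A full game-tree search with the given number of moves left. On Bob's turn a legal move must
-- exist, since a stuck Bob has won; this is the test with the constant `true`.
aliceWinsᵇ : ℕ → Player → Position n → Bool
aliceWinsᵇ {n} zero    _     ps = does (n ℕ.≤? length ps)
aliceWinsᵇ     (suc k) alice ps = someLegal ps (aliceWinsᵇ k bob)
aliceWinsᵇ {n} (suc k) bob   ps =
  does (length ps ℕ.<? n) ∧ someLegal ps (λ _ → true) ∧ everyLegal ps (aliceWinsᵇ k alice)

-- Soundness of the evaluation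

≡true⇒T : ∀ {b} → b ≡ true → T b
≡true⇒T refl = tt

T-if : ∀ {A : Set} {x y} (a? : Dec A) → T (if does a? then x else y) → (A × T x) ⊎ (¬ A × T y)
T-if (yes a) t = inj₁ (a , t)
T-if (no ¬a) t = inj₂ (¬a , t)

module _ {g : Fin n → ℕ} (graceful : Graceful g) where
  open Graceful graceful

  -- This is why rejecting inadmissible placements loses no graceful extension: the values of `g`
  -- are never rejected.
  graceful⇒admissible : AllPairs DifferentVertices ps → All (λ (i , b) → g i ≡ b) ps →
    ∀ {p} → ¬ ((p , g p) ∈ ps) → Admissible ps p (g p)
  graceful⇒admissible {ps = ps} uniq agree {p} p∉ =
    All.zip (fresh , unused) , bounded p ,
    separated⇒newEdges separates (All.map (cong just) agree) uniq fresh refl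
    where
    fresh : All (λ (i , _) → i ≢ p) ps
    fresh = All.tabulate λ where i∈ refl → p∉ (subst (λ b → (p , b) ∈ ps) (sym (All.lookup agree i∈)) i∈)

    unused : All (λ (_ , b) → b ≢ g p) ps
    unused = All.tabulate λ where
      i∈ refl → All.lookup fresh i∈ (injective (All.lookup agree i∈))

  -- The search is followed along `g`: whichever branch `place` takes at the value of `g`, the
  -- resulting list still agrees with `g`. The continuation form lets the two endpoints of an edge
  -- be chained.
  place-sound : AllPairs DifferentVertices ps → All (λ (i , b) → g i ≡ b) ps →
    ∀ p {a} → g p ≡ a → ∀ next → T (place ps p a next) →
    (∀ qs → AllPairs DifferentVertices qs → All (λ (i , b) → g i ≡ b) qs → ¬ T (next qs)) → ⊥
  place-sound {ps = ps} uniq agree p refl next t fails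
    with T-if (Any.any? (≡-dec Fin._≟_ ℕ._≟_ (p , g p)) ps) t
  ... | inj₁ (_ , t₁)  = fails ps uniq agree t₁
  ... | inj₂ (p∉ , t₁) with T-if (admissible? ps p (g p)) t₁
  ...   | inj₁ ((fresh , _) , t₂) = fails ((p , g p) ∷ ps)
    (All.map (λ (i≢p , _) p≡i → i≢p (sym p≡i)) fresh ∷ uniq) (refl ∷ agree) t₂
  ...   | inj₂ (¬adm , _) = ¬adm (graceful⇒admissible uniq agree p∉)

T-⇒ : ∀ {A : Set} {b} (a? : Dec A) → T (not (does a?) ∨ b) → A → T b
T-⇒ (yes _) t _ = t
T-⇒ (no ¬a) _ a = contradiction a ¬a

all-lookup : ∀ {A : Set} (p : A → Bool) {xs x} → T (all p xs) → x ∈ xs → T (p x)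
all-lookup p {xs} t = All.lookup (Allₚ.all⁺ p xs t)

allWhere-lookup : ∀ {A : Set} {Q : A → Set} (Q? : ∀ x → Dec (Q x)) (p : A → Bool) xs →
  T (allWhere Q? p xs) → ∀ x → x ∈ xs → Q x → T (p x)
allWhere-lookup Q? p xs t x x∈ = T-⇒ (Q? x) (all-lookup (λ x → not (does (Q? x)) ∨ p x) t x∈)

any-witness : ∀ {A : Set} (p : A → Bool) xs → T (any p xs) → ∃[ x ] T (p x)
any-witness p xs t = Any.satisfied (Anyₚ.any⁻ p xs t)

T-does-∧ : ∀ {A : Set} {b} (a? : Dec A) → T (does a? ∧ b) → A × T b
T-does-∧ (yes a) t = a , t

-- A graceful extension has an edge labelled `d`, and its endpoints are among the attempts, so the
-- refutation of that attempt applies to `g` and induction goes on with `pred d`. The bound `k ≤ d`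
-- keeps all labels tried positive.
doomedᵇ-sound : ∀ k d → k ≤ d → d ≤ edges n → AllPairs DifferentVertices ps →
  T (doomedᵇ {n} k d ps) → Doomed ps
doomedᵇ-sound {n} {ps} (suc k) d k<d d≤m uniq t g graceful agree =
  realised (every-label-occurs graceful (≤-trans (s≤s z≤n) k<d) d≤m)
  where
  finish : ℕ → Position n → Fin n → Bool
  finish a qs q = place qs q (a + d) (doomedᵇ k (pred d))

  close : Fin n → ℕ → Position n → Bool
  close p a qs = allWhere (adj? p) (finish a qs) (allFin n)

  realised : ∃[ p ] ∃[ q ] Adj p q × g q ≡ g p + d → ⊥
  realised (p , q , p~q , eq) =
    place-sound graceful uniq agree p refl (close p (g p))
      (all-lookup (λ a → place ps p a (close p a))
        (all-lookup (λ p → all (λ a → place ps p a (close p a)) (upTo (suc (edges n ∸ d))))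
          t (∈-allFin p))
        (∈-upTo⁺ (s≤s (m+n≤o⇒m≤o∸n (g p) (subst (_≤ edges n) eq (Graceful.bounded graceful q))))))
      λ qs uniq₁ agree₁ t₁ →
        place-sound graceful uniq₁ agree₁ q eq (doomedᵇ k (pred d))
          (allWhere-lookup (adj? p) (finish (g p) qs) (allFin n) t₁ q (∈-allFin q) p~q)
          λ rs uniq₂ agree₂ t₂ → doomedᵇ-sound k (pred d) (pred-mono-≤ k<d)
            (≤-trans pred[n]≤n d≤m) uniq₂ t₂ g graceful agree₂

dooming-sound : 3 ≤ edges n → AllPairs DifferentVertices ps → T (dooming {n} ps) → Doomed ps
dooming-sound {n} 3≤m = doomedᵇ-sound 3 (edges n) 3≤m ≤-refl

-- A free vertex could be put in front of the list, giving more than `n` distinct vertices; the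
-- label 0 there is a dummy.
long⇒complete : Reachable {n} ps f → n ≤ length ps → Complete f
long⇒complete r n≤len v free = <-irrefl refl (≤-trans (unique⇒length≤n {ps = (v , 0) ∷ _}
  (All.map (λ i≢v v≡i → i≢v (sym v≡i)) (fresh-vertex free (agrees r)) ∷ vertices-unique r)) n≤len)

short⇒incomplete : Reachable {n} ps f → length ps < n → ¬ Complete f
short⇒incomplete {n} {ps} {f} r short complete =
  <-irrefl refl (≤-trans short (Finₚ.injective⇒≤ {f = λ v → Any.index (entry v)} entry-injective))
  where
  entry : ∀ v → Any (λ (i , _) → i ≡ v) ps
  entry v with f v in eq
  ... | just b  = Any.map (λ where refl → refl) (listed r eq)
  ... | nothing = contradiction eq (complete v)

  entry-injective : ∀ {v w} → Any.index (entry v) ≡ Any.index (entry w) → v ≡ w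
  entry-injective {v} {w} eq = trans (sym (Anyₚ.lookup-index (entry v)))
    (trans (cong (λ k → proj₁ (lookup ps k)) eq) (Anyₚ.lookup-index (entry w)))

module _ (r : Reachable {n} ps f) (next : Position n → Bool) where

  someLegal-sound : T (someLegal ps next) → ∃[ v ] ∃[ l ] Legal f v l × T (next ((v , l) ∷ ps))
  someLegal-sound t =
    let l , t₁   = any-witness (λ l → any (attempt l) (allFin n)) (edges n ∷ upTo (edges n)) t
        v , t₂   = any-witness (attempt l) (allFin n) t₁
        adm , t₃ = T-does-∧ (admissible? ps v l) t₂
    in v , l , admissible⇒legal r adm , t₃
    where
    attempt : ℕ → Fin n → Bool
    attempt l v = does (admissible? ps v l) ∧ next ((v , l) ∷ ps)

  everyLegal-sound : T (everyLegal ps next) → ∀ v l → Legal f v l → T (next ((v , l) ∷ ps))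
  everyLegal-sound t v l legal@(_ , l≤m , _) =
    allWhere-lookup (admissible? ps v) (next ∘ play v) (upTo (suc (edges n)))
      (all-lookup (λ v → allWhere (admissible? ps v) (next ∘ play v) (upTo (suc (edges n)))) t (∈-allFin v))
      l (∈-upTo⁺ (s≤s l≤m)) (legal⇒admissible r legal)
    where
    play : Fin n → ℕ → Position n
    play v l = (v , l) ∷ ps

module _ (3≤m : 3 ≤ edges n) where

  bobDooms-sound : Reachable {n} ps f → T (bobDooms ps) → BobWins f bob
  bobDooms-sound r t =
    let v , l , legal , t₁ = someLegal-sound r dooming t
        r′ = move r legal
    in bobMoves v l legal (doomed⇒BobWins r′ (dooming-sound 3≤m (vertices-unique r′) t₁) alice)

  aliceLost-sound : ∀ ps {f} → Reachable {n} ps f → T (aliceLost ps) → BobWins f bob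
  aliceLost-sound ps r t = case (Equivalence.to (T-∨ {dooming ps} {bobDooms ps}) t)
    where
    case : T (dooming ps) ⊎ T (bobDooms ps) → BobWins _ bob
    case (inj₁ t₁) = doomed⇒BobWins r (dooming-sound 3≤m (vertices-unique r) t₁) bob
    case (inj₂ t₁) = bobDooms-sound r t₁

  aliceTrapped-sound : Reachable {n} ps f → T (aliceTrapped ps) → BobWins f alice
  aliceTrapped-sound {ps} r t = trapped (T-does-∧ (length ps ℕ.<? n) t)
    where
    trapped : length ps < n × T (everyLegal ps aliceLost) → BobWins _ alice
    trapped (short , t₁) = aliceMoves (short⇒incomplete r short) λ v l legal →
      aliceLost-sound ((v , l) ∷ ps) (move r legal) (everyLegal-sound r aliceLost t₁ v l legal)

  bobReplies-sound : Reachable {n} ps f → T (bobReplies ps) → BobWins f bob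
  bobReplies-sound r t =
    let v , l , legal , t₁ = someLegal-sound r aliceTrapped t
    in bobMoves v l legal (aliceTrapped-sound (move r legal) t₁)

aliceWinsᵇ-sound : ∀ k p → Reachable {n} ps f → T (aliceWinsᵇ k p ps) → AliceWins f p
aliceWinsᵇ-sound {n} {ps} zero p r t = finished (long⇒complete r (≤ᵇ⇒≤ n (length ps) t))
aliceWinsᵇ-sound (suc k) alice r t =
  let v , l , legal , t₁ = someLegal-sound r (aliceWinsᵇ k bob) t
  in aliceMoves v l legal (aliceWinsᵇ-sound k bob (move r legal) t₁)
aliceWinsᵇ-sound {n} {ps} (suc k) bob r t =
  let short , t₁   = T-does-∧ (length ps ℕ.<? n) t
      some , every = Equivalence.to (T-∧ {x = someLegal ps λ _ → true}) t₁
      v , l , legal , _ = someLegal-sound r (λ _ → true) some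
  in bobMoves (short⇒incomplete r short) (v , l , legal) λ v l legal →
       aliceWinsᵇ-sound k alice (move r legal)
         (everyLegal-sound r (aliceWinsᵇ k alice) every v l legal)

-- Symmetries of the game

record Symmetry (n : ℕ) : Set where
  field
    σ            : Fin n → Fin n
    ρ            : ℕ → ℕ
    σ-involutive : ∀ v → σ (σ v) ≡ v
    ρ-involutive : ∀ {l} → l ≤ edges n → ρ (ρ l) ≡ l
    ρ-bounded    : ∀ {l} → l ≤ edges n → ρ l ≤ edges n
    σ-adj        : ∀ {i j} → Adj i j → Adj (σ i) (σ j)
    ρ-distance   : ∀ {a b} → a ≤ edges n → b ≤ edges n → ∣ ρ a - ρ b ∣ ≡ ∣ a - b ∣

map-just⁻¹ : ∀ {A B : Set} {h : A → B} (x : Maybe A) {b} → Maybe.map h x ≡ just b →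
  ∃[ a ] x ≡ just a × h a ≡ b
map-just⁻¹ (just a) refl = a , refl , refl

module _ (sym′ : Symmetry n) where
  open Symmetry sym′

  -- The relation is pointwise, since the mirror image of `assign f v l` agrees with the mirrored
  -- move only value by value. The bound is carried along because `ρ` is assumed involutive and
  -- distance-preserving only on labels up to `edges n`.
  record Mirrored (f f′ : Labeling n) : Set where
    field
      mirror  : ∀ v → f′ v ≡ Maybe.map ρ (f (σ v))
      bounded : ∀ v {a} → f v ≡ just a → a ≤ edges n

    mirror-σ : ∀ v → f′ (σ v) ≡ Maybe.map ρ (f v)
    mirror-σ v = trans (mirror (σ v)) (cong (Maybe.map ρ ∘ f) (σ-involutive v))

    unmirror : ∀ {v b} → f′ v ≡ just b → ∃[ a ] f (σ v) ≡ just a × ρ a ≡ b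
    unmirror {v} eq = map-just⁻¹ (f (σ v)) (trans (sym (mirror v)) eq)

  open Mirrored

  -- Both maps are involutions, so the same symmetry leads back; moves can then be transported in
  -- either direction.
  mirrored-sym : {f f′ : Labeling n} → Mirrored f f′ → Mirrored f′ f
  mirrored-sym {f} {f′} M .mirror v = trans (back (f v) (M .bounded v)) (cong (Maybe.map ρ) (sym (mirror-σ M v)))
    where
    back : ∀ (x : Maybe ℕ) → (∀ {a} → x ≡ just a → a ≤ edges n) → x ≡ Maybe.map ρ (Maybe.map ρ x)
    back nothing  _       = refl
    back (just a) bounded = cong just (sym (ρ-involutive (bounded refl)))
  mirrored-sym M .bounded v eq with a , fσv , refl ← unmirror M eq = ρ-bounded (M .bounded (σ v) fσv)

  mirrored-assign : {f f′ : Labeling n} → Mirrored f f′ → ∀ {v l} → l ≤ edges n →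
    Mirrored (assign f v l) (assign f′ (σ v) (ρ l))
  mirrored-assign {f} {f′} M {v} {l} _ .mirror u with u Fin.≟ σ v
  ... | yes refl = cong (Maybe.map ρ) (sym (trans (cong (assign f v l) (σ-involutive v)) (assign-at f v l)))
  ... | no u≢σv  = trans (M .mirror u) (cong (Maybe.map ρ) (sym (assign-other f v l σu≢v)))
    where
    σu≢v : σ u ≢ v
    σu≢v refl = u≢σv (sym (σ-involutive u))
  mirrored-assign {f} M {v} {l} l≤m .bounded u eq with assign-inv f v l u eq
  ... | inj₁ (_ , refl) = l≤m
  ... | inj₂ (_ , fu)   = M .bounded u fu

  σ-injective : ∀ {u v} → σ u ≡ σ v → u ≡ v
  σ-injective {u} {v} eq = trans (sym (σ-involutive u)) (trans (cong σ eq) (σ-involutive v))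

  mirrored-separated : {f f′ : Labeling n} → Mirrored f f′ → Separated f → Separated f′
  mirrored-separated M sep i~j k~l fi fj fk fl eq
    with a , fi′ , refl ← unmirror M fi | b , fj′ , refl ← unmirror M fj
       | c , fk′ , refl ← unmirror M fk | d , fl′ , refl ← unmirror M fl
    with sep (σ-adj i~j) (σ-adj k~l) fi′ fj′ fk′ fl′
           (trans (sym (ρ-distance (M .bounded _ fi′) (M .bounded _ fj′)))
             (trans eq (ρ-distance (M .bounded _ fk′) (M .bounded _ fl′))))
  ... | inj₁ (p , q) = inj₁ (σ-injective p , σ-injective q)
  ... | inj₂ (p , q) = inj₂ (σ-injective p , σ-injective q)

  mirrored-legal : {f f′ : Labeling n} → Mirrored f f′ → ∀ {v l} → Legal f v l → Legal f′ (σ v) (ρ l)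
  mirrored-legal M {v} {l} (free , l≤m , unused , distinct) =
    trans (mirror-σ M v) (cong (Maybe.map ρ) free) , ρ-bounded l≤m , unused′ ,
    separated⇒distinct (mirrored-separated (mirrored-assign M l≤m) (distinct⇒separated distinct))
    where
    unused′ : ∀ u → _ ≢ just (ρ l)
    unused′ u eq with a , fu , ρa≡ρl ← unmirror M eq =
      unused (σ u) (trans fu (cong just (trans (sym (ρ-involutive (M .bounded (σ u) fu)))
        (trans (cong ρ ρa≡ρl) (ρ-involutive l≤m)))))

  mirrored-complete : {f f′ : Labeling n} → Mirrored f f′ → Complete f′ → Complete f
  mirrored-complete M complete v free =
    complete (σ v) (trans (mirror-σ M v) (cong (Maybe.map ρ) free))

  mirrored-BobWins : {f f′ : Labeling n} → Mirrored f f′ → ∀ {p} → BobWins f p → BobWins f′ p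
  mirrored-BobWins M (stuck incomplete none) =
    stuck (incomplete ∘ mirrored-complete M) λ v l legal → none _ _ (mirrored-legal (mirrored-sym M) legal)
  mirrored-BobWins M (bobMoves v l legal wins) =
    bobMoves (σ v) (ρ l) (mirrored-legal M legal)
      (mirrored-BobWins (mirrored-assign M (proj₁ (proj₂ legal))) wins)
  mirrored-BobWins M (aliceMoves incomplete wins) =
    aliceMoves (incomplete ∘ mirrored-complete M) λ v l legal →
      -- Alice moves on the mirrored side, so her move is pulled back along the reversed mirror.
      -- Mirroring it forward would yield `σ (σ v)` and `ρ (ρ l)` in place of `v` and `l`.
      mirrored-BobWins (mirrored-sym (mirrored-assign (mirrored-sym M) (proj₁ (proj₂ legal))))
        (wins (σ v) (ρ l) (mirrored-legal (mirrored-sym M) legal))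

  opening-symmetric : ∀ {v x p} → x ≤ edges n →
    BobWins (assign empty (σ v) (ρ x)) p → BobWins (assign empty v x) p
  opening-symmetric x≤m = mirrored-BobWins (mirrored-sym (mirrored-assign empty-mirrored x≤m))
    where
    empty-mirrored : Mirrored empty empty
    empty-mirrored .mirror _ = refl
    empty-mirrored .bounded _ ()

reflection : ∀ n → Symmetry n
reflection n = record
  { σ = opposite ; ρ = λ l → l
  ; σ-involutive = Finₚ.opposite-involutive ; ρ-involutive = λ _ → refl ; ρ-bounded = λ l≤m → l≤m
  ; σ-adj = λ where (inj₁ e) → inj₂ (edge e)
                    (inj₂ e) → inj₁ (edge e)
  ; ρ-distance = λ _ _ → refl }
  where
  edge : {i j : Fin n} → Edge i j → Edge (opposite j) (opposite i)
  edge {i} {j} (i<j , j≤i+2) rewrite Finₚ.opposite-prop i | Finₚ.opposite-prop j =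
    ∸-monoʳ-< (s≤s i<j) (Finₚ.toℕ<n j) ,
    (begin
      n ∸ suc (toℕ i)            ≤⟨ m≤n+m∸n _ 2 ⟩
      2 + (n ∸ suc (toℕ i) ∸ 2)  ≡⟨ cong (2 +_) (∸-+-assoc n (suc (toℕ i)) 2) ⟩
      2 + (n ∸ (suc (toℕ i) + 2)) ≤⟨ +-monoʳ-≤ 2 (∸-monoʳ-≤ n (s≤s j≤i+2)) ⟩
      2 + (n ∸ suc (toℕ j))      ≡⟨ +-comm 2 _ ⟩
      n ∸ suc (toℕ j) + 2        ∎)
    where open ≤-Reasoning

∣m∸a-m∸b∣≡∣a-b∣ : ∀ {m a b} → a ≤ m → b ≤ m → ∣ m ∸ a - m ∸ b ∣ ≡ ∣ a - b ∣
∣m∸a-m∸b∣≡∣a-b∣ {m} {zero}  {b} z≤n b≤m = trans (m≤n⇒∣n-m∣≡n∸m (m∸n≤m m b)) (m∸[m∸n]≡n b≤m)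
∣m∸a-m∸b∣≡∣a-b∣ {m} {suc a} {zero} a≤m z≤n = trans (m≤n⇒∣m-n∣≡n∸m (m∸n≤m m (suc a))) (m∸[m∸n]≡n a≤m)
∣m∸a-m∸b∣≡∣a-b∣ (s≤s a≤m) (s≤s b≤m) = ∣m∸a-m∸b∣≡∣a-b∣ a≤m b≤m

complement : ∀ n → Symmetry n
complement n = record
  { σ = λ v → v ; ρ = edges n ∸_
  ; σ-involutive = λ _ → refl ; ρ-involutive = m∸[m∸n]≡n ; ρ-bounded = λ {l} _ → m∸n≤m (edges n) l
  ; σ-adj = λ i~j → i~j ; ρ-distance = ∣m∸a-m∸b∣≡∣a-b∣ }

-- Positions without graceful extension

module _ {g : Fin n → ℕ} (graceful : Graceful g) where
  open Graceful graceful

  -- The larger end of the edge is at most `j + d`, which leaves at most `j` for the smaller end.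
  high-label-occurs : ∀ j {d} → 0 < d → j + d ≡ edges n →
    ∃[ p ] ∃[ q ] Adj p q × g p ≤ j × g q ≡ g p + d
  high-label-occurs j {d} 0<d j+d≡m
    with p , q , p~q , eq ← every-label-occurs graceful 0<d (subst (d ≤_) j+d≡m (m≤n+m d j)) =
    p , q , p~q , +-cancelʳ-≤ d (g p) j (subst₂ _≤_ eq (sym j+d≡m) (bounded q)) , eq

  zero-max-adjacent : 0 < edges n → ∃[ p ] ∃[ q ] Adj p q × g p ≡ 0 × g q ≡ edges n
  zero-max-adjacent 0<m with p , q , p~q , gp≤0 , eq ← high-label-occurs 0 0<m refl =
    p , q , p~q , n≤0⇒n≡0 gp≤0 , trans eq (cong (_+ edges n) (n≤0⇒n≡0 gp≤0))

nonadjacent-extremes : 0 < edges n → ∀ {v w : Fin n} → (v , 0) ∈ ps → (w , edges n) ∈ ps →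
  ¬ Adj v w → Doomed ps
nonadjacent-extremes 0<m v∈ w∈ v≁w g graceful agree
  with p , q , p~q , gp , gq ← zero-max-adjacent graceful 0<m =
  v≁w (subst₂ Adj (same gp (All.lookup agree v∈)) (same gq (All.lookup agree w∈)) p~q)
  where
  same : ∀ {i j a} → g i ≡ a → g j ≡ a → i ≡ j
  same gi gj = Graceful.injective graceful (trans gi (sym gj))

neighbours-0F : ∀ {k} {q : Fin (3 + k)} → Adj 0F q → q ≡ 1F ⊎ q ≡ 2F
neighbours-0F {q = q@0F} q~q = contradiction refl (Adj⇒≢ {i = q} {q} q~q)
neighbours-0F {q = 1F} _ = inj₁ refl
neighbours-0F {q = 2F} _ = inj₂ refl
neighbours-0F {q = suc (suc (suc q))} 0~q = contradiction 0~q (far⇒¬Adj (m≤m+n 3 (toℕ q)))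

neighbours-1F : ∀ {k} {p : Fin (4 + k)} → Adj p 1F → p ≡ 0F ⊎ p ≡ 2F ⊎ p ≡ 3F
neighbours-1F {p = 0F} _ = inj₁ refl
neighbours-1F {p = p@1F} p~p = contradiction refl (Adj⇒≢ {i = p} {p} p~p)
neighbours-1F {p = 2F} _ = inj₂ (inj₁ refl)
neighbours-1F {p = 3F} _ = inj₂ (inj₂ refl)
neighbours-1F {p = suc (suc (suc (suc p)))} p~1 =
  contradiction (swap p~1) (far⇒¬Adj (m≤m+n 4 (toℕ p)))

neighbours-2F : ∀ {k} {p : Fin (5 + k)} → Adj p 2F → p ≡ 0F ⊎ p ≡ 1F ⊎ p ≡ 3F ⊎ p ≡ 4F
neighbours-2F {p = 0F} _ = inj₁ refl
neighbours-2F {p = 1F} _ = inj₂ (inj₁ refl)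
neighbours-2F {p = p@2F} p~p = contradiction refl (Adj⇒≢ {i = p} {p} p~p)
neighbours-2F {p = 3F} _ = inj₂ (inj₂ (inj₁ refl))
neighbours-2F {p = 4F} _ = inj₂ (inj₂ (inj₂ refl))
neighbours-2F {p = suc (suc (suc (suc (suc p))))} p~2 =
  contradiction (swap p~2) (far⇒¬Adj (m≤m+n 5 (toℕ p)))

below-2 : ∀ {a} → a ≤ 1 → a ≡ 0 ⊎ a ≡ 1
below-2 z≤n       = inj₁ refl
below-2 (s≤s z≤n) = inj₂ refl

below-3 : ∀ {a} → a ≤ 2 → a ≡ 0 ⊎ a ≡ 1 ⊎ a ≡ 2
below-3 z≤n             = inj₁ refl
below-3 (s≤s z≤n)       = inj₂ (inj₁ refl)
below-3 (s≤s (s≤s z≤n)) = inj₂ (inj₂ refl)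

∣1+m-m∣≡1 : ∀ m → ∣ suc m - m ∣ ≡ 1
∣1+m-m∣≡1 zero    = refl
∣1+m-m∣≡1 (suc m) = ∣1+m-m∣≡1 m

-- With n = 6 + k this reads 2n − 3 = (n − 1) + (n − 2).
edges-split : ∀ k → edges (6 + k) ≡ 5 + k + (4 + k)
edges-split k = cong (3 +_) (trans (cong (λ j → k + (6 + j)) (+-identityʳ k))
  (trans (+-suc k (5 + k)) (cong suc (+-suc k (4 + k)))))

module _ {k : ℕ} {g : Fin (6 + k) → ℕ} (graceful : Graceful g) (g0 : g 0F ≡ 0) where
  open Graceful graceful

  private
    m m-1 m-2 : ℕ
    m   = edges (6 + k)
    m-1 = m ∸ 1
    m-2 = m ∸ 2

    at : ∀ {i j a} → g i ≡ a → g j ≡ a → i ≡ j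
    at gi gj = injective (trans gi (sym gj))

    absurd : ∀ {i a b} → g i ≡ a → g i ≡ b → a ≢ b → ⊥
    absurd gi gi′ a≢b = a≢b (trans (sym gi) gi′)

    max-near-0F : g 1F ≡ m ⊎ g 2F ≡ m
    max-near-0F with p , q , p~q , gp , gq ← zero-max-adjacent graceful (s≤s z≤n)
      with refl ← at gp g0 with neighbours-0F p~q
    ... | inj₁ refl = inj₁ gq
    ... | inj₂ refl = inj₂ gq

    second-highest : ∃[ p ] ∃[ q ] Adj p q ×
      ((p ≡ 0F × g q ≡ m-1) ⊎ (g p ≡ 1 × g q ≡ m))
    second-highest with p , q , p~q , low , eq ← high-label-occurs graceful 1 {m-1} (s≤s z≤n) refl
      with below-2 low
    ... | inj₁ gp = p , q , p~q , inj₁ (at gp g0 , trans eq (cong (_+ m-1) gp))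
    ... | inj₂ gp = p , q , p~q , inj₂ (gp , trans eq (cong (_+ m-1) gp))

    third-highest : ∃[ p ] ∃[ q ] Adj p q ×
      ((p ≡ 0F × g q ≡ m-2) ⊎ (g p ≡ 1 × g q ≡ m-1) ⊎ (g p ≡ 2 × g q ≡ m))
    third-highest with p , q , p~q , low , eq ← high-label-occurs graceful 2 {m-2} (s≤s z≤n) refl
      with below-3 low
    ... | inj₁ gp        = p , q , p~q , inj₁ (at gp g0 , trans eq (cong (_+ m-2) gp))
    ... | inj₂ (inj₁ gp) = p , q , p~q , inj₂ (inj₁ (gp , trans eq (cong (_+ m-2) gp)))
    ... | inj₂ (inj₂ gp) = p , q , p~q , inj₂ (inj₂ (gp , trans eq (cong (_+ m-2) gp)))

  -- The label m is forced onto 1F, so m − 1 needs label 1 on 3F; then the edges 2F–3F and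
  -- 1F–2F both carry n − 2.
  ¬0F↦0∧2F↦n-1 : g 2F ≡ 5 + k → ⊥
  ¬0F↦0∧2F↦n-1 g2 with max-near-0F
  ... | inj₂ g2′ = absurd g2 g2′ λ eq → m+1+n≢m (5 + k) (sym (trans eq (edges-split k)))
  ... | inj₁ g1 with second-highest
  ...   | p , q , p~q , inj₁ (refl , gq) with neighbours-0F p~q
  ...     | inj₁ refl = absurd g1 gq 1+n≢n
  ...     | inj₂ refl = absurd g2 gq λ eq → m+1+n≢m (5 + k)
    (sym (suc-injective (trans (cong suc eq) (trans (edges-split k) (+-suc (5 + k) (3 + k))))))
  ¬0F↦0∧2F↦n-1 g2 | inj₁ g1 | p , q , p~q , inj₂ (gp , gq) with refl ← at gq g1
    with neighbours-1F p~q
  ...     | inj₁ refl        = absurd g0 gp λ ()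
  ...     | inj₂ (inj₁ refl) = absurd g2 gp λ ()
  ...     | inj₂ (inj₂ refl)
    -- With 1 on `3F` the first distance computes to `4 + k`; the second is `m` less `5 + k`, which
    -- `edges-split` evaluates.
    with separates {3F} {2F} {1F} {2F} (from-yes (adj? {6 + k} 3F 2F)) (from-yes (adj? {6 + k} 1F 2F))
           (cong just gp) (cong just g2) (cong just g1) (cong just g2)
           (sym (trans (∣-∣-comm m (5 + k)) (trans (cong (∣ 5 + k -_∣) (edges-split k)) (∣m-m+n∣≡n (5 + k) (4 + k)))))
  ...       | inj₁ (() , _)
  ...       | inj₂ (() , _)

  -- Label m − 1 is forced onto t′, so m − 2 needs label 2 on a neighbour of t other than 0F and
  -- t′; all of these are adjacent to 5F, which repeats the label 1 of the edge t–t′.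
  ¬0F↦0∧t↦m∧5F↦1 : (t t′ : Fin (6 + k)) →
    (∀ {q} → Adj 0F q → q ≡ t ⊎ q ≡ t′) → (∀ {p} → Adj p t → p ≡ 0F ⊎ p ≡ t′ ⊎ Adj p 5F) →
    Adj t t′ → ¬ Adj 5F t → ¬ Adj 5F t′ → t ≢ 5F → t′ ≢ 5F →
    g t ≡ m → g 5F ≡ 1 → ⊥
  ¬0F↦0∧t↦m∧5F↦1 t t′ near-0F near-t t~t′ 5≁t 5≁t′ t≢5 t′≢5 gt g5 = third (second second-highest)
    where
    second : ∃[ p ] ∃[ q ] Adj p q × ((p ≡ 0F × g q ≡ m-1) ⊎ (g p ≡ 1 × g q ≡ m)) → g t′ ≡ m-1
    second (p , q , p~q , inj₁ (refl , gq)) with near-0F p~q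
    ... | inj₁ refl = contradiction (trans (sym gt) gq) 1+n≢n
    ... | inj₂ refl = gq
    second (p , q , p~q , inj₂ (gp , gq)) =
      contradiction (subst₂ Adj (at gp g5) (at gq gt) p~q) 5≁t

    third : g t′ ≡ m-1 → ⊥
    third gt′ with third-highest
    ... | p , q , p~q , inj₂ (inj₁ (gp , gq)) = 5≁t′ (subst₂ Adj (at gp g5) (at gq gt′) p~q)
    ... | p , q , p~q , inj₁ (refl , gq) with near-0F p~q
    ...   | inj₁ refl = absurd gt gq (m≢1+n+m m-2 {1} ∘ sym)
    ...   | inj₂ refl = absurd gt′ gq 1+n≢n
    third gt′ | p , q , p~q , inj₂ (inj₂ (gp , gq)) with near-t (subst (Adj p) (at gq gt) p~q)
    ...   | inj₁ refl        = absurd g0 gp λ ()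
    ...   | inj₂ (inj₁ refl) = absurd gp gt′ λ eq → m+1+n≢0 k (sym (suc-injective (suc-injective eq)))
    ...   | inj₂ (inj₂ p~5)
      with separates p~5 t~t′ (cong just gp) (cong just g5) (cong just gt) (cong just gt′)
             (sym (∣1+m-m∣≡1 m-1))
    ...     | inj₁ (_ , 5≡t′) = t′≢5 (sym 5≡t′)
    ...     | inj₂ (_ , 5≡t)  = t≢5 (sym 5≡t)

  ¬0F↦0∧1F↦m∧5F↦1 : g 1F ≡ m → g 5F ≡ 1 → ⊥
  ¬0F↦0∧1F↦m∧5F↦1 = ¬0F↦0∧t↦m∧5F↦1 1F 2F neighbours-0F near (from-yes (adj? {6 + k} 1F 2F))
    (from-no (adj? {6 + k} 5F 1F)) (from-no (adj? {6 + k} 5F 2F)) (λ ()) (λ ())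
    where
    near : ∀ {p} → Adj p 1F → p ≡ 0F ⊎ p ≡ 2F ⊎ Adj p 5F
    near p~1 with neighbours-1F p~1
    ... | inj₁ p≡0         = inj₁ p≡0
    ... | inj₂ (inj₁ p≡2)  = inj₂ (inj₁ p≡2)
    ... | inj₂ (inj₂ refl) = inj₂ (inj₂ (from-yes (adj? {6 + k} 3F 5F)))

  ¬0F↦0∧2F↦m∧5F↦1 : g 2F ≡ m → g 5F ≡ 1 → ⊥
  ¬0F↦0∧2F↦m∧5F↦1 = ¬0F↦0∧t↦m∧5F↦1 2F 1F (swap ∘ neighbours-0F) near (from-yes (adj? {6 + k} 2F 1F))
    (from-no (adj? {6 + k} 5F 2F)) (from-no (adj? {6 + k} 5F 1F)) (λ ()) (λ ())
    where
    near : ∀ {p} → Adj p 2F → p ≡ 0F ⊎ p ≡ 1F ⊎ Adj p 5F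
    near p~2 with neighbours-2F p~2
    ... | inj₁ p≡0                = inj₁ p≡0
    ... | inj₂ (inj₁ p≡1)         = inj₂ (inj₁ p≡1)
    ... | inj₂ (inj₂ (inj₁ refl)) = inj₂ (inj₂ (from-yes (adj? {6 + k} 3F 5F)))
    ... | inj₂ (inj₂ (inj₂ refl)) = inj₂ (inj₂ (from-yes (adj? {6 + k} 4F 5F)))

  -- The label m − 1 needs label 1 on 3F or 4F, whose edge to 5F then repeats the label x of 0F–1F.
  ¬0F↦0∧1F↦x∧2F↦m∧5F↦1+x : ∀ {x} → x ≢ 1 → x ≢ m-1 →
    g 1F ≡ x → g 2F ≡ m → g 5F ≡ suc x → ⊥
  ¬0F↦0∧1F↦x∧2F↦m∧5F↦1+x {x} x≢1 x≢m-1 g1 g2 g5 = second second-highest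
    where
    repeated : ∀ {p} → Adj p 5F → g p ≡ 1 → ⊥
    repeated p~5 gp with separates {k = 0F} {1F} p~5 (from-yes (adj? {6 + k} 0F 1F))
      (cong just gp) (cong just g5) (cong just g0) (cong just g1) refl
    ... | inj₁ (_ , ())
    ... | inj₂ (_ , ())

    second : ∃[ p ] ∃[ q ] Adj p q × ((p ≡ 0F × g q ≡ m-1) ⊎ (g p ≡ 1 × g q ≡ m)) → ⊥
    second (p , q , p~q , inj₁ (refl , gq)) with neighbours-0F p~q
    ... | inj₁ refl = absurd g1 gq x≢m-1
    ... | inj₂ refl = absurd g2 gq 1+n≢n
    second (p , q , p~q , inj₂ (gp , gq)) with neighbours-2F (subst (Adj p) (at gq g2) p~q)
    ... | inj₁ refl                = absurd g0 gp λ ()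
    ... | inj₂ (inj₁ refl)         = absurd g1 gp x≢1
    ... | inj₂ (inj₂ (inj₁ refl))  = repeated (from-yes (adj? {6 + k} 3F 5F)) gp
    ... | inj₂ (inj₂ (inj₂ refl))  = repeated (from-yes (adj? {6 + k} 4F 5F)) gp

-- Bob's strategy

opening-legal : ∀ {v : Fin n} {x} → x ≤ edges n → Legal empty v x
opening-legal x≤m = admissible⇒legal start ([] , x≤m , [] , [])

dooming-move : Reachable {n} ps f → ∀ w l → Admissible ps w l → Doomed ((w , l) ∷ ps) → BobWins f bob
dooming-move r w l adm doomed = bobMoves w l legal (doomed⇒BobWins (move r legal) doomed alice)
  where
  legal = admissible⇒legal r adm

-- Bob's strategy for n ≥ 9

module Large (k : ℕ) where

  -- Here n = 9 + k, so `N` is n - 1. As m = 2N - 1, it is also the midpoint of the labels 1 and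
  -- `m`.
  N m : ℕ
  N = 8 + k
  m = edges (9 + k)

  m≡N+7+k : m ≡ N + (7 + k)
  m≡N+7+k = edges-split (3 + k)

  2N≡1+m : 2 * N ≡ suc m
  2N≡1+m = trans (cong (N +_) (+-identityʳ N)) (trans (+-suc N (7 + k)) (cong suc (sym m≡N+7+k)))

  N<m : N < m
  N<m = subst (N <_) (sym m≡N+7+k) (m<m+n N (s≤s z≤n))

  -- Equality would make `m` equal to 2y, but `m` is odd. Hence an edge from `m` to `y` never
  -- repeats the label of an edge from `y` to 0.
  complement-differs : ∀ {y} → y ≤ m → ∣ m - y ∣ ≢ ∣ y - 0 ∣
  complement-differs {y} y≤m eq = even≢odd N y (trans 2N≡1+m (cong suc (begin
    m               ≡⟨ m+[n∸m]≡n y≤m ⟨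
    y + (m ∸ y)     ≡⟨ cong (y +_) (m≤n⇒∣n-m∣≡n∸m y≤m) ⟨
    y + ∣ m - y ∣   ≡⟨ cong (y +_) (trans eq (∣-∣-identityʳ y)) ⟩
    y + y           ≡⟨ cong (y +_) (+-identityʳ y) ⟨
    2 * y           ∎)))
    where open ≡-Reasoning

  distance-to-max-injective : ∀ {x y} → x ≤ m → y ≤ m → ∣ m - x ∣ ≡ ∣ m - y ∣ → x ≡ y
  distance-to-max-injective x≤m y≤m eq = ∸-cancelˡ-≡ x≤m y≤m
    (trans (sym (m≤n⇒∣n-m∣≡n∸m x≤m)) (trans eq (m≤n⇒∣n-m∣≡n∸m y≤m)))

  -- Only the midpoint `N` is equally far from 1 and `m`.
  distance-from-1 : ∀ {x} → x ≤ m → x ≢ 0 → x ≢ N → ∣ 1 - x ∣ ≢ ∣ m - x ∣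
  distance-from-1 {zero}  _   x≢0 _   _  = x≢0 refl
  distance-from-1 {suc x} x<m _   x≢N eq = x≢N (*-cancelˡ-≡ (suc x) N 2 (begin
    2 * suc x                 ≡⟨ cong (suc x +_) (+-identityʳ (suc x)) ⟩
    suc x + suc x             ≡⟨ +-suc (suc x) x ⟩
    suc (suc x + x)           ≡⟨ cong (λ y → suc (suc x + y)) (trans eq (m≤n⇒∣n-m∣≡n∸m x<m)) ⟩
    suc (suc x + (m ∸ suc x)) ≡⟨ cong suc (m+[n∸m]≡n x<m) ⟩
    suc m                     ≡⟨ 2N≡1+m ⟨
    2 * N                     ∎))
    where open ≡-Reasoning

  far-from-0F : ∀ {w : Fin (9 + k)} → 3 ≤ toℕ w → ¬ Adj 0F w
  far-from-0F = far⇒¬Adj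

  -- `8F` is out of reach of vertices up to 5, and `3F` of all later ones; the existence of `8F` is
  -- where n ≥ 9 enters. The last component ensures that a vertex `u` with index at most 2 cannot be
  -- adjacent to both `w` and `v`.
  away : (v : Fin (9 + k)) → ∃[ w ] 3 ≤ toℕ w × w ≢ v × ¬ Adj w v × (5 ≤ toℕ w ⊎ 6 ≤ toℕ v)
  away v with toℕ v ℕ.≤? 5
  ... | yes v≤5 = 8F , m≤m+n 3 5 , (λ where refl → from-no (8 ℕ.≤? 5) v≤5) ,
    far⇒¬Adj {i = v} (+-monoʳ-≤ 3 v≤5) ∘ swap , inj₁ (m≤m+n 5 3)
  ... | no  v≰5 = 3F , ≤-refl , (λ where refl → v≰5 (m≤m+n 3 2)) ,
    far⇒¬Adj {i = 3F} {v} (≰⇒> v≰5) , inj₂ (≰⇒> v≰5)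

  other : (u v : Fin (9 + k)) → ∃[ w ] 3 ≤ toℕ w × w ≢ u × w ≢ v
  other u v with 3F Fin.≟ u | 3F Fin.≟ v | 4F Fin.≟ u | 4F Fin.≟ v
  ... | no 3≢u   | no 3≢v   | _        | _        = 3F , ≤-refl , 3≢u , 3≢v
  ... | _        | _        | no 4≢u   | no 4≢v   = 4F , n≤1+n 3 , 4≢u , 4≢v
  ... | yes refl | _        | _        | yes refl = 5F , m≤m+n 3 2 , (λ ()) , (λ ())
  ... | _        | yes refl | yes refl | _        = 5F , m≤m+n 3 2 , (λ ()) , (λ ())
  ... | _        | yes refl | _        | yes ()

  first-extreme : ∀ v → BobWins (assign empty v 0) bob
  first-extreme v = let w , _ , w≢v , w≁v , _ = away v in
    dooming-move (move start (opening-legal z≤n)) w m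
      (((w≢v ∘ sym) , (λ ())) ∷ [] , ≤-refl , [] ∷ [] , (λ w~v → contradiction w~v w≁v) ∷ [])
      (nonadjacent-extremes (s≤s z≤n) (there (here refl)) (here refl) (w≁v ∘ swap))

  N-to-max : ∣ N - m ∣ ≡ 7 + k
  N-to-max = trans (cong (∣ N -_∣) m≡N+7+k) (∣m-m+n∣≡n N (7 + k))

  N-to-max≢N : ∣ N - m ∣ ≢ N
  N-to-max≢N eq = 1+n≢n (trans (sym eq) N-to-max)

  N-to-max≢m : ∣ N - m ∣ ≢ m
  N-to-max≢m eq = <-irrefl (trans (sym N-to-max) eq) (<-trans (n<1+n (7 + k)) N<m)

  1F≁5F : ¬ Adj {9 + k} 1F 5F
  1F≁5F = from-no (adj? {9 + k} 1F 5F)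

  2F≁5F : ¬ Adj {9 + k} 2F 5F
  2F≁5F = from-no (adj? {9 + k} 2F 5F)

  0F≁5F : ¬ Adj {9 + k} 0F 5F
  0F≁5F = from-no (adj? {9 + k} 0F 5F)

  module _ {x : ℕ} {f : Labeling (9 + k)} where

    -- As `5F` is adjacent to none of `0F`, `1F`, `2F`, the label `x` only has to differ from `N`.
    -- The new edges at `2F` get n - 2 and n - 1, beside the old label `m`.
    max-on-1F : x ≢ N → Reachable ((1F , m) ∷ (0F , 0) ∷ (5F , x) ∷ []) f → BobWins f bob
    max-on-1F x≢N r = dooming-move r 2F N
      ( ((λ ()) , m≢N) ∷ ((λ ()) , (λ ())) ∷ ((λ ()) , x≢N) ∷ []
      , <⇒≤ N<m
      , ((λ _ _ → N-to-max≢N) ∷ (λ _ 2~5 → contradiction 2~5 2F≁5F) ∷ [])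
        ∷ ((λ _ 2~5 → contradiction 2~5 2F≁5F) ∷ []) ∷ [] ∷ []
      , (λ _ → ((λ _ → N-to-max≢m) ∷ (λ 1~5 → contradiction 1~5 1F≁5F) ∷ [])
               ∷ ((λ 0~5 → contradiction 0~5 0F≁5F) ∷ []) ∷ [] ∷ [])
        ∷ (λ _ → ((λ _ → m≢N ∘ sym) ∷ (λ 1~5 → contradiction 1~5 1F≁5F) ∷ [])
               ∷ ((λ 0~5 → contradiction 0~5 0F≁5F) ∷ []) ∷ [] ∷ [])
        ∷ (λ 2~5 → contradiction 2~5 2F≁5F) ∷ [])
      λ where g graceful (g2 ∷ _ ∷ g0 ∷ _) → ¬0F↦0∧2F↦n-1 graceful g0 g2
      where
      m≢N : m ≢ N
      m≢N eq = <-irrefl (sym eq) N<m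

    -- Bob's label is the predecessor `y` of `x`. The exclusion of 1 keeps `y` from being 0; those
    -- of 2 and `m` make `y` differ from 1 and m - 1, as the refutation requires.
    max-on-2F : x ≤ m → x ≢ 0 → x ≢ 1 → x ≢ 2 → x ≢ m →
      Reachable ((2F , m) ∷ (0F , 0) ∷ (5F , x) ∷ []) f → BobWins f bob
    max-on-2F = answer x
      where
      answer : ∀ x → x ≤ m → x ≢ 0 → x ≢ 1 → x ≢ 2 → x ≢ m →
        Reachable ((2F , m) ∷ (0F , 0) ∷ (5F , x) ∷ []) f → BobWins f bob
      answer zero    _   x≢0 _   _   _   _ = contradiction refl x≢0
      answer (suc y) y<m _   x≢1 x≢2 x≢m r = dooming-move r 1F y
        ( ((λ ()) , λ m≡y → <-irrefl (sym m≡y) y<m) ∷ ((λ ()) , x≢1 ∘ cong suc ∘ sym)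
          ∷ ((λ ()) , 1+n≢n) ∷ []
        , <⇒≤ y<m
        , ((λ _ _ eq → complement-differs (<⇒≤ y<m) (trans (∣-∣-comm m y) eq))
            ∷ (λ _ 1~5 → contradiction 1~5 1F≁5F) ∷ [])
          ∷ ((λ _ 1~5 → contradiction 1~5 1F≁5F) ∷ []) ∷ [] ∷ []
        , (λ _ → ((λ _ eq → x≢1 (cong suc (y-to-max≢m eq))) ∷ (λ 2~5 → contradiction 2~5 2F≁5F) ∷ [])
                 ∷ ((λ 0~5 → contradiction 0~5 0F≁5F) ∷ []) ∷ [] ∷ [])
          ∷ (λ _ → ((λ _ eq → <-irrefl (trans (sym (∣-∣-identityʳ y)) eq) y<m)
                    ∷ (λ 2~5 → contradiction 2~5 2F≁5F) ∷ [])
                 ∷ ((λ 0~5 → contradiction 0~5 0F≁5F) ∷ []) ∷ [] ∷ [])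
          ∷ (λ 1~5 → contradiction 1~5 1F≁5F) ∷ [])
        λ where g graceful (g1 ∷ g2 ∷ g0 ∷ g5 ∷ _) →
                  ¬0F↦0∧1F↦x∧2F↦m∧5F↦1+x graceful g0 (x≢2 ∘ cong suc) (x≢m ∘ cong suc) g1 g2 g5
        where
        y-to-max≢m : ∣ y - m ∣ ≡ m → y ≡ 0
        y-to-max≢m eq = distance-to-max-injective (<⇒≤ y<m) z≤n (trans (∣-∣-comm m y) eq)

  distance-from-1≢m : ∀ {x} → x ≤ m → x ≢ 0 → ∣ 1 - x ∣ ≢ m
  distance-from-1≢m {zero}  _   x≢0 _  = x≢0 refl
  distance-from-1≢m {suc x} x<m _   eq = <-irrefl eq x<m

  1-on-5F-dooms : ∀ {u} {ps : Position (9 + k)} → u ≡ 1F ⊎ u ≡ 2F → Doomed ((5F , 1) ∷ (u , m) ∷ (0F , 0) ∷ ps)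
  1-on-5F-dooms (inj₁ refl) g graceful (g5 ∷ g1 ∷ g0 ∷ _) = ¬0F↦0∧1F↦m∧5F↦1 graceful g0 g1 g5
  1-on-5F-dooms (inj₂ refl) g graceful (g5 ∷ g2 ∷ g0 ∷ _) = ¬0F↦0∧2F↦m∧5F↦1 graceful g0 g2 g5

  near-0F-far-from-5F : ∀ {u : Fin (9 + k)} → u ≡ 1F ⊎ u ≡ 2F → ¬ Adj 5F u
  near-0F-far-from-5F (inj₁ refl) 5~1 = 1F≁5F (swap 5~1)
  near-0F-far-from-5F (inj₂ refl) 5~2 = 2F≁5F (swap 5~2)

  near-0F≢5F : ∀ {u : Fin (9 + k)} → u ≡ 1F ⊎ u ≡ 2F → u ≢ 5F
  near-0F≢5F (inj₁ refl) ()
  near-0F≢5F (inj₂ refl) ()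

  module Second {v : Fin (9 + k)} {x : ℕ} (3≤v : 3 ≤ toℕ v) (x≤m : x ≤ m)
                (x≢0 : x ≢ 0) (x≢1 : x ≢ 1) (x≢2 : x ≢ 2) (x≢N : x ≢ N) (x≢m : x ≢ m) where

    after : Fin (9 + k) → ℕ → Position (9 + k)
    after u y = (u , y) ∷ (0F , 0) ∷ (v , x) ∷ []

    0≁v : ¬ Adj 0F v
    0≁v = far-from-0F 3≤v

    module Reply {u : Fin (9 + k)} {y : ℕ} {f : Labeling (9 + k)} (r : Reachable (after u y) f)
                 (x≢y : x ≢ y) (y≤m : y ≤ m) where

      -- The three conditions are the collisions left open: the edge `w`-`v` against `u`-`0F` and
      -- `u`-`v`, and `w`-`u` against `u`-`v`. Parity separates `w`-`u` from `u`-`0F`, and `x ≢ y`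
      -- separates the two new edges.
      put-max-on : y ≢ m → ∀ w → 3 ≤ toℕ w → w ≢ u → w ≢ v →
        (Adj w v → Adj u 0F → ∣ m - x ∣ ≢ ∣ y - 0 ∣) →
        (Adj w v → Adj u v → ∣ m - x ∣ ≢ ∣ y - x ∣) →
        (Adj w u → Adj u v → ∣ m - y ∣ ≢ ∣ y - x ∣) → BobWins f bob
      put-max-on y≢m w 3≤w w≢u w≢v c₁ c₂ c₃ = dooming-move r w m
        ( (w≢u ∘ sym , y≢m) ∷ (0≢w , λ ()) ∷ (w≢v ∘ sym , x≢m) ∷ []
        , ≤-refl
        , ((λ _ w~0 → contradiction (swap w~0) 0≁w) ∷
           (λ _ _ eq → x≢y (sym (distance-to-max-injective y≤m x≤m eq))) ∷ [])
          ∷ ((λ w~0 → contradiction (swap w~0) 0≁w) ∷ []) ∷ [] ∷ []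
        , (λ w~u → ((λ _ → complement-differs y≤m) ∷ c₃ w~u ∷ [])
                   ∷ ((λ 0~v → contradiction 0~v 0≁v) ∷ []) ∷ [] ∷ [])
          ∷ (λ w~0 → contradiction (swap w~0) 0≁w)
          ∷ (λ w~v → (c₁ w~v ∷ c₂ w~v ∷ [])
                     ∷ ((λ 0~v → contradiction 0~v 0≁v) ∷ []) ∷ [] ∷ []) ∷ [])
        (nonadjacent-extremes (s≤s z≤n) (there (there (here refl))) (here refl) 0≁w)
        where
        0≁w : ¬ Adj 0F w
        0≁w = far-from-0F 3≤w

        0≢w : 0F ≢ w
        0≢w 0≡w = n≮0 (subst (λ i → 3 ≤ toℕ i) (sym 0≡w) 3≤w)

      -- Only labels |y − x| and y can be repeated, so it suffices to put m away from v or from u.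
      punish : y ≢ m → BobWins f bob
      punish y≢m with toℕ u ℕ.≤? 2 | away v
      ... | yes u≤2 | w , 3≤w , w≢v , w≁v , apart =
        put-max-on y≢m w 3≤w (λ where refl → from-no (3 ℕ.≤? 2) (≤-trans 3≤w u≤2)) w≢v
          (λ w~v → contradiction w~v w≁v) (λ w~v → contradiction w~v w≁v)
          λ w~u u~v → contradiction (w~u , u~v) (not-both apart)
        where
        not-both : 5 ≤ toℕ w ⊎ 6 ≤ toℕ v → ¬ (Adj w u × Adj u v)
        not-both (inj₁ 5≤w) (w~u , _) = far⇒¬Adj {i = u} (≤-trans (+-monoʳ-≤ 3 u≤2) 5≤w) (swap w~u)
        not-both (inj₂ 6≤v) (_ , u~v) = far⇒¬Adj {i = u} (≤-trans (+-monoʳ-≤ 3 u≤2) (<⇒≤ 6≤v)) u~v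
      ... | no u≰2 | w , 3≤w , w≢v , w≁v , _ with adj? u v | ∣ m - y ∣ ℕ.≟ ∣ y - x ∣ | away u
      ...   | no u≁v | _ | _ = let z , 3≤z , z≢u , z≢v = other u v in
        put-max-on y≢m z 3≤z z≢u z≢v (λ _ u~0 → contradiction (swap u~0) (far-from-0F (≰⇒> u≰2)))
          (λ _ u~v → contradiction u~v u≁v) (λ _ u~v → contradiction u~v u≁v)
      ...   | yes u~v | no differ | _ =
        put-max-on y≢m w 3≤w (λ where refl → w≁v u~v) w≢v
          (λ w~v → contradiction w~v w≁v) (λ w~v → contradiction w~v w≁v) (λ _ _ → differ)
      -- Avoiding `u`, a collision of `z`-`v` with `u`-`v` would together with `same` put `x` and
      -- `y` at equal distance from `m`, forcing `x ≡ y`.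
      ...   | yes u~v | yes same | z , 3≤z , z≢u , z≁u , _ =
        put-max-on y≢m z 3≤z z≢u (λ where refl → z≁u (swap u~v))
          (λ _ u~0 → contradiction (swap u~0) (far-from-0F (≰⇒> u≰2)))
          (λ _ _ eq → x≢y (distance-to-max-injective x≤m y≤m (trans eq (sym same))))
          (λ z~u → contradiction z~u z≁u)

    -- The only possible new edge is `5F`-`v`. It must avoid the label `m` of `u`-`0F` and, if `u`
    -- and `v` are adjacent, the distance from `m` to `x`.
    put-1-on-5F : ∀ {u f} → u ≡ 1F ⊎ u ≡ 2F → v ≢ 5F → Reachable (after u m) f → BobWins f bob
    put-1-on-5F {u} u∈ v≢5 r = dooming-move r 5F 1
      ( (near-0F≢5F u∈ , (λ ())) ∷ ((λ ()) , (λ ())) ∷ (v≢5 , x≢1) ∷ []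
      , s≤s z≤n
      , ((λ 5~u → contradiction 5~u 5≁u) ∷ (λ 5~u → contradiction 5~u 5≁u) ∷ [])
        ∷ ((λ 5~0 → contradiction (swap 5~0) 0F≁5F) ∷ []) ∷ [] ∷ []
      , (λ 5~u → contradiction 5~u 5≁u)
        ∷ (λ 5~0 → contradiction (swap 5~0) 0F≁5F)
        ∷ (λ _ → ((λ _ → distance-from-1≢m x≤m x≢0) ∷ (λ _ → distance-from-1 x≤m x≢0 x≢N) ∷ [])
                 ∷ ((λ 0~v → contradiction 0~v 0≁v) ∷ []) ∷ [] ∷ []) ∷ [])
      (1-on-5F-dooms u∈)
      where
      5≁u : ¬ Adj 5F u
      5≁u = near-0F-far-from-5F u∈

    max-reply : ∀ u {f} → 0F ≢ u → Reachable (after u m) f → BobWins f bob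
    max-reply 0F 0≢0 _ = contradiction refl 0≢0
    max-reply 1F {f} _ r with v Fin.≟ 5F
    ... | no v≢5  = put-1-on-5F (inj₁ refl) v≢5 r
    ... | yes v≡5 = max-on-1F x≢N (subst (λ v → Reachable ((1F , m) ∷ (0F , 0) ∷ (v , x) ∷ []) f) v≡5 r)
    max-reply 2F {f} _ r with v Fin.≟ 5F
    ... | no v≢5  = put-1-on-5F (inj₂ refl) v≢5 r
    ... | yes v≡5 = max-on-2F x≤m x≢0 x≢1 x≢2 x≢m
      (subst (λ v → Reachable ((2F , m) ∷ (0F , 0) ∷ (v , x) ∷ []) f) v≡5 r)
    max-reply (suc (suc (suc u))) _ r = doomed⇒BobWins r
      (nonadjacent-extremes (s≤s z≤n) (there (here refl)) (here refl) (far-from-0F (m≤m+n 3 (toℕ u)))) bob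

    put-0-on-0F : ∀ {f} → Reachable ((0F , 0) ∷ (v , x) ∷ []) f → BobWins f alice
    put-0-on-0F r = aliceMoves (short⇒incomplete r (m≤m+n 3 (6 + k))) λ u y legal →
      respond u y (move r legal) (legal⇒admissible r legal)
      where
      respond : ∀ u y {f} → Reachable (after u y) f → Admissible ((0F , 0) ∷ (v , x) ∷ []) u y → BobWins f bob
      respond u y r ((0≢u , _) ∷ (_ , x≢y) ∷ [] , y≤m , _) with y ℕ.≟ m
      ... | yes refl = max-reply u 0≢u r
      ... | no  y≢m  = Reply.punish r x≢y y≤m y≢m

    second-player-wins : BobWins (assign empty v x) bob
    second-player-wins = bobMoves 0F 0 legal (put-0-on-0F (move r legal))
      where
      r : Reachable ((v , x) ∷ []) (assign empty v x)
      r = move start (opening-legal x≤m)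

      legal : Legal (assign empty v x) 0F 0
      legal = admissible⇒legal r
        ( ((λ v≡0 → n≮0 (subst (λ i → 3 ≤ toℕ i) v≡0 3≤v)) , x≢0) ∷ [] , z≤n , [] ∷ []
        , (λ 0~v → contradiction 0~v 0≁v) ∷ [])

  module _ {u : Fin (9 + k)} {y : ℕ} {f : Labeling (9 + k)} (r : Reachable ((u , y) ∷ (0F , 0) ∷ []) f) where

    -- The only possible collision is between the new edge at `u` and `u`-`0F`, which parity
    -- excludes.
    put-max-aside : y ≢ m → y ≤ m → BobWins f bob
    put-max-aside y≢m y≤m =
      let w , 3≤w , w≢u , _ = other u u
          0≁w = far-from-0F 3≤w
      in dooming-move r w m
        ( (w≢u ∘ sym , y≢m) ∷ ((λ 0≡w → n≮0 (subst (λ i → 3 ≤ toℕ i) (sym 0≡w) 3≤w)) , (λ ())) ∷ []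
        , ≤-refl
        , ((λ _ w~0 → contradiction (swap w~0) 0≁w) ∷ []) ∷ [] ∷ []
        , (λ _ → ((λ _ → complement-differs y≤m) ∷ []) ∷ [] ∷ [])
          ∷ (λ w~0 → contradiction (swap w~0) 0≁w) ∷ [])
        (nonadjacent-extremes (s≤s z≤n) (there (there (here refl))) (here refl) 0≁w)

  module _ {u : Fin (9 + k)} {f : Labeling (9 + k)} (r : Reachable ((u , m) ∷ (0F , 0) ∷ []) f) where

    put-1-on-5F : u ≡ 1F ⊎ u ≡ 2F → BobWins f bob
    put-1-on-5F u∈ = dooming-move r 5F 1
      ( (near-0F≢5F u∈ , (λ ())) ∷ ((λ ()) , (λ ())) ∷ []
      , s≤s z≤n
      , ((λ 5~u → contradiction 5~u (near-0F-far-from-5F u∈)) ∷ []) ∷ [] ∷ []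
      , (λ 5~u → contradiction 5~u (near-0F-far-from-5F u∈))
        ∷ (λ 5~0 → contradiction (swap 5~0) 0F≁5F) ∷ [])
      (1-on-5F-dooms u∈)

  first-player-wins : BobWins {9 + k} empty bob
  first-player-wins = bobMoves 0F 0 (opening-legal z≤n)
    (aliceMoves (short⇒incomplete r (m≤m+n 2 (7 + k))) λ u y legal →
      respond u y (move r legal) (legal⇒admissible r legal))
    where
    r : Reachable ((0F , 0) ∷ []) (assign empty 0F 0)
    r = move start (opening-legal z≤n)

    max-reply : ∀ u {f} → 0F ≢ u → Reachable ((u , m) ∷ (0F , 0) ∷ []) f → BobWins f bob
    max-reply 0F 0≢0 _ = contradiction refl 0≢0
    max-reply 1F _ r = put-1-on-5F r (inj₁ refl)
    max-reply 2F _ r = put-1-on-5F r (inj₂ refl)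
    max-reply (suc (suc (suc u))) _ r = doomed⇒BobWins r
      (nonadjacent-extremes (s≤s z≤n) (there (here refl)) (here refl) (far-from-0F (m≤m+n 3 (toℕ u)))) bob

    respond : ∀ u y {f} → Reachable ((u , y) ∷ (0F , 0) ∷ []) f → Admissible ((0F , 0) ∷ []) u y → BobWins f bob
    respond u y r ((0≢u , _) ∷ [] , y≤m , _) with y ℕ.≟ m
    ... | yes refl = max-reply u 0≢u r
    ... | no  y≢m  = put-max-aside r y≢m y≤m

  module _ (x : ℕ) (x≤m : x ≤ m) (x≢0 : x ≢ 0) (x≢m : x ≢ m) where

    -- The complement carries the exceptional labels 1, 2 and `N` to m - 1, m - 2 and N - 1, none of
    -- which is exceptional.
    any-label : ∀ {v} → 3 ≤ toℕ v → BobWins (assign empty v x) bob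
    any-label {v} 3≤v with x ℕ.≟ 1 | x ℕ.≟ 2 | x ℕ.≟ N
    ... | no x≢1 | no x≢2 | no x≢N = Second.second-player-wins 3≤v x≤m x≢0 x≢1 x≢2 x≢N x≢m
    ... | yes refl | _ | _ = opening-symmetric (complement (9 + k)) x≤m
      (Second.second-player-wins 3≤v (m∸n≤m m 1) (λ ()) (λ ()) (λ ()) m-1≢N (1+n≢n ∘ sym))
      where
      m-1≢N : m ∸ 1 ≢ N
      m-1≢N eq = m+1+n≢m N (suc-injective (trans (sym (+-suc N (6 + k))) (trans (sym m≡N+7+k) (cong suc eq))))
    ... | _ | yes refl | _ = opening-symmetric (complement (9 + k)) x≤m
      (Second.second-player-wins 3≤v (m∸n≤m m 2) (λ ()) (λ ()) (λ ()) m-2≢N (m≢1+n+m (m ∸ 2) {1}))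
      where
      m-2≢N : m ∸ 2 ≢ N
      m-2≢N eq = m+1+n≢m N (suc-injective (suc-injective (trans (cong suc (sym (+-suc N (5 + k))))
        (trans (sym (+-suc N (6 + k))) (trans (sym m≡N+7+k) (cong (2 +_) eq))))))
    ... | _ | _ | yes refl = opening-symmetric (complement (9 + k)) x≤m
      (subst (λ l → BobWins (assign empty v l) bob) (sym m∸N≡7+k)
        (Second.second-player-wins 3≤v (<⇒≤ 7+k<m) (λ ()) (λ ()) (λ ()) (1+n≢n ∘ sym) (λ eq → <-irrefl eq 7+k<m)))
      where
      7+k<m : 7 + k < m
      7+k<m = <-trans (n<1+n (7 + k)) N<m

      m∸N≡7+k : m ∸ N ≡ 7 + k
      m∸N≡7+k = trans (cong (_∸ N) m≡N+7+k) (m+n∸m≡n N (7 + k))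

    any-vertex : ∀ v → BobWins (assign empty v x) bob
    any-vertex v with 3 ℕ.≤? toℕ v
    ... | yes 3≤v = any-label 3≤v
    -- The reflection of a vertex at most 2 has index at least n - 3.
    ... | no  3≰v = opening-symmetric (reflection (9 + k)) x≤m (any-label
      (subst (3 ≤_) (sym (Finₚ.opposite-prop v)) (≤-trans (m≤m+n 3 (3 + k)) (∸-monoʳ-≤ (9 + k) (≰⇒> 3≰v)))))

  every-opening : ∀ v x → x ≤ m → BobWins (assign empty v x) bob
  every-opening v x x≤m with x ℕ.≟ 0 | x ℕ.≟ m
  ... | yes refl | _ = first-extreme v
  ... | _ | yes refl = opening-symmetric (complement (9 + k)) x≤m
    (subst (λ l → BobWins (assign empty v l) bob) (sym (n∸n≡0 m)) (first-extreme v))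
  ... | no x≢0 | no x≢m = any-vertex x x≤m x≢0 x≢m v

  bobWins : ∀ p → BobWins {9 + k} empty p
  bobWins alice = aliceMoves (short⇒incomplete start (s≤s z≤n)) λ v x (_ , x≤m , _) → every-opening v x x≤m
  bobWins bob   = first-player-wins

-- Evaluation for 4 ≤ n ≤ 8

repliesAt : Fin n → ℕ → Bool
repliesAt v x = bobReplies ((v , x) ∷ [])

-- With the restriction on vertices in `openingsAnswered`, at least one opening of every orbit under
-- reflection and complement is evaluated.
vertexAnswered : Fin n → Bool
vertexAnswered {n} v = allWhere (λ x → x ℕ.≤? edges n ∸ x) (repliesAt v) (upTo (suc (edges n)))

openingsAnswered : ℕ → Bool
openingsAnswered n = allWhere (λ v → toℕ v ℕ.≤? toℕ (opposite v)) vertexAnswered (allFin n)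

-- The argument is generic in `n`, so the search is run only in the `refl` proofs supplied for each
-- numeral.
module Small (n : ℕ) (3≤m : 3 ≤ edges n) (0<n : 0 < n) (answered : openingsAnswered n ≡ true) where

  low-opening : ∀ v x → x ≤ edges n → toℕ v ≤ toℕ (opposite v) → x ≤ edges n ∸ x →
    BobWins (assign empty v x) bob
  low-opening v x x≤m v≤ x≤ = bobReplies-sound {n} 3≤m {(v , x) ∷ []} (move start (opening-legal x≤m))
    (allWhere-lookup (λ x → x ℕ.≤? edges n ∸ x) (repliesAt v) (upTo (suc (edges n)))
      (allWhere-lookup (λ v → toℕ v ℕ.≤? toℕ (opposite v)) vertexAnswered (allFin n) (≡true⇒T answered)
        v (∈-allFin v) v≤)
      x (∈-upTo⁺ (s≤s x≤m)) x≤)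

  half-opening : ∀ v x → x ≤ edges n → x ≤ edges n ∸ x → BobWins (assign empty v x) bob
  half-opening v x x≤m x≤ = [ (λ v≤ → low-opening v x x≤m v≤ x≤) , reflected ]′ (≤-total (toℕ v) (toℕ (opposite v)))
    where
    reflected : toℕ (opposite v) ≤ toℕ v → BobWins (assign empty v x) bob
    reflected ≤v = opening-symmetric (reflection n) x≤m (low-opening (opposite v) x x≤m
      (subst (toℕ (opposite v) ≤_) (cong toℕ (sym (Finₚ.opposite-involutive v))) ≤v) x≤)

  every-opening : ∀ v x → x ≤ edges n → BobWins (assign empty v x) bob
  every-opening v x x≤m = [ half-opening v x x≤m , complemented ]′ (≤-total x (edges n ∸ x))
    where
    complemented : edges n ∸ x ≤ x → BobWins (assign empty v x) bob
    complemented ≤x = opening-symmetric (complement n) x≤m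
      (half-opening v (edges n ∸ x) (m∸n≤m (edges n) x)
        (subst (edges n ∸ x ≤_) (sym (m∸[m∸n]≡n x≤m)) ≤x))

  bobWins : bobReplies {n} [] ≡ true → ∀ p → BobWins {n} empty p
  bobWins _  alice = aliceMoves (short⇒incomplete start 0<n) λ v x (_ , x≤m , _) → every-opening v x x≤m
  bobWins eq bob   = bobReplies-sound {n} 3≤m {[]} start (≡true⇒T eq)

theorem13 : ((n : ℕ) → n ≥ 4 → (p : Player) → BobWins {n} empty p)
    × ((p : Player) → AliceWins {3} empty p)
theorem13 = bobWins , aliceWins
  where
  bobWins : (n : ℕ) → n ≥ 4 → (p : Player) → BobWins {n} empty p
  bobWins 0 ()
  bobWins 1 (s≤s ())
  bobWins 2 (s≤s (s≤s ()))
  bobWins 3 (s≤s (s≤s (s≤s ())))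
  -- The first argument after the numeral shows 3 ≤ `edges n`, the values of `edges n` being 5, 7,
  -- 9, 11 and 13.
  bobWins 4 _ = Small.bobWins 4 (m≤m+n 3 2)  (s≤s z≤n) refl refl
  bobWins 5 _ = Small.bobWins 5 (m≤m+n 3 4)  (s≤s z≤n) refl refl
  bobWins 6 _ = Small.bobWins 6 (m≤m+n 3 6)  (s≤s z≤n) refl refl
  bobWins 7 _ = Small.bobWins 7 (m≤m+n 3 8)  (s≤s z≤n) refl refl
  bobWins 8 _ = Small.bobWins 8 (m≤m+n 3 10) (s≤s z≤n) refl refl
  bobWins (suc (suc (suc (suc (suc (suc (suc (suc (suc k))))))))) _ = Large.bobWins k

  aliceWins : (p : Player) → AliceWins {3} empty p
  aliceWins alice = aliceWinsᵇ-sound 3 alice start (≡true⇒T refl)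
  aliceWins bob   = aliceWinsᵇ-sound 3 bob start (≡true⇒T refl)
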